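{- Let $r\in\mathbb{N}$. For any $m_1,\ldots,m_r\in \mathbb{N}$, with $m=\operatorname{lcm}[m_1,\ldots,m_r]$, $$E(m_1,\ldots,m_r)= \frac1{m}\sum_{d\mid m} c_{m_1}(d)\cdots c_{m_r}(d)\,\phi(m/d).$$
   Context: $\mathbb{N}=\{1,2,\ldots\}$. $\phi$ is Euler's totient function. For $n,k\in\mathbb{N}$ the Ramanujan sum is $c_n(k)=\sum_{1\le j\le n,\ \gcd(j,n)=1}\exp(2\pi i jk/n)$. For $m_1,\ldots,m_r\in\mathbb{N}$ with $m=\operatorname{lcm}[m_1,\ldots,m_r]$, the function $E$ is defined by $E(m_1,\ldots,m_r)=\frac1{M}\sum_{k=1}^M c_{m_1}(k)\cdots c_{m_r}(k)$, where $M$ is any positive integer with $m\mid M$ (the value does not depend on the choice of $M$, so one may take $M=m$). The sum in the claim is over positive divisors $d$ of $m$. -}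

module Defs where

open import Data.Fin using (Fin; zero; suc)
open import Data.Integer as ℤ using (+_)
import Data.Integer.Properties as ℤ
open import Data.List using (List; foldr; filter; length; applyUpTo; upTo; allFin)
open import Data.Nat as ℕ using (ℕ; zero; suc; NonZero; z≤n; s≤s)
open import Data.Nat.Divisibility using (_∣?_)
open import Data.Nat.GCD using (gcd)
open import Data.Nat.LCM using (lcm; gcd*lcm)
import Data.Nat.Properties as ℕ
open import Data.Product using (∃; _×_; _,_; proj₁; proj₂)
open import Data.Rational
  using (ℚ; _+_; _*_; _-_; -_; ∣_∣; _≤_; _<_; 0ℚ; 1ℚ; ½; _/_; _≤?_; _<?_)
import Data.Rational as ℚ
import Data.Rational.Properties as ℚ
open import Data.Rational.Solver using (module +-*-Solver)
open import Data.Rational.Unnormalised using (mkℚᵘ; *≡*; *≤*; _≃_)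
import Data.Rational.Unnormalised.Properties as ℚᵘ
open import Data.Sum using (_⊎_; inj₁; inj₂)
open import Function using (_∘_)
open import Relation.Binary.PropositionalEquality
open import Relation.Nullary.Decidable using (from-yes)

open +-*-Solver using (solve; _:+_; _:*_; _:-_; :-_; _:=_; con)
open ℚ.≤-Reasoning

0≤1 : 0ℚ ≤ 1ℚ
0≤1 = from-yes (0ℚ ≤? 1ℚ)

*-monoʳ : ∀ {c a b} → 0ℚ ≤ c → a ≤ b → c * a ≤ c * b
*-monoʳ {c} 0≤c = ℚ.*-monoˡ-≤-nonNeg c {{ℚ.nonNegative 0≤c}}

*-monoˡ : ∀ {c a b} → 0ℚ ≤ c → a ≤ b → a * c ≤ b * c
*-monoˡ {c} 0≤c = ℚ.*-monoʳ-≤-nonNeg c {{ℚ.nonNegative 0≤c}}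

*-mono : ∀ {a b c d} → 0ℚ ≤ a → 0ℚ ≤ d → a ≤ b → c ≤ d → a * c ≤ b * d
*-mono 0≤a 0≤d a≤b c≤d = ℚ.≤-trans (*-monoʳ 0≤a c≤d) (*-monoˡ 0≤d a≤b)

0≤+ : ∀ {a b} → 0ℚ ≤ a → 0ℚ ≤ b → 0ℚ ≤ a + b
0≤+ = ℚ.+-mono-≤

0≤* : ∀ {a b} → 0ℚ ≤ a → 0ℚ ≤ b → 0ℚ ≤ a * b
0≤* {a} {b} 0≤a 0≤b = begin
  0ℚ      ≡⟨ ℚ.*-zeroʳ a ⟨
  a * 0ℚ  ≤⟨ *-monoʳ 0≤a 0≤b ⟩
  a * b   ∎

≤+ʳ : ∀ {a b} → 0ℚ ≤ b → a ≤ a + b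
≤+ʳ {a} {b} 0≤b = begin
  a       ≡⟨ ℚ.+-identityʳ a ⟨
  a + 0ℚ  ≤⟨ ℚ.+-monoʳ-≤ a 0≤b ⟩
  a + b   ∎

≤+ˡ : ∀ {a b} → 0ℚ ≤ a → b ≤ a + b
≤+ˡ {a} {b} 0≤a = ℚ.≤-trans (≤+ʳ 0≤a) (ℚ.≤-reflexive (ℚ.+-comm b a))

∣∣≤ : ∀ {a b} → a ≤ b → - a ≤ b → ∣ a ∣ ≤ b
∣∣≤ {a} h h′ with ℚ.∣p∣≡p∨∣p∣≡-p a
... | inj₁ eq = ℚ.≤-trans (ℚ.≤-reflexive eq) h
... | inj₂ eq = ℚ.≤-trans (ℚ.≤-reflexive eq) h′

≤∣∣ : ∀ a → a ≤ ∣ a ∣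
≤∣∣ a with ℚ.≤-total 0ℚ a
... | inj₁ h = ℚ.≤-reflexive (sym (ℚ.0≤p⇒∣p∣≡p h))
... | inj₂ h = ℚ.≤-trans h (ℚ.0≤∣p∣ a)

-≤∣∣ : ∀ a → - a ≤ ∣ a ∣
-≤∣∣ a = subst (- a ≤_) (ℚ.∣-p∣≡∣p∣ a) (≤∣∣ (- a))

infix 5 _+i_
record ℚ[i] : Set where
  no-eta-equality
  pattern
  constructor _+i_
  field
    re im : ℚ
open ℚ[i] public

infixl 6 _⊕_ _⊖_
infixl 7 _⊗_ _•_

_⊕_ _⊖_ _⊗_ : ℚ[i] → ℚ[i] → ℚ[i]
(a +i b) ⊕ (c +i d) = a + c +i b + d
(a +i b) ⊖ (c +i d) = a - c +i b - d
(a +i b) ⊗ (c +i d) = a * c - b * d +i a * d + b * c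

_•_ : ℚ → ℚ[i] → ℚ[i]
r • (a +i b) = r * a +i r * b

0ᵍ 1ᵍ iᵍ : ℚ[i]
0ᵍ = 0ℚ +i 0ℚ
1ᵍ = 1ℚ +i 0ℚ
iᵍ = 0ℚ +i 1ℚ

-- Any norm defines the same Cauchy sequences and the same null sequences;
-- this one, unlike the modulus, is rational-valued.
∥_∥ : ℚ[i] → ℚ
∥ a +i b ∥ = ∣ a ∣ + ∣ b ∣

0≤∥∥ : ∀ z → 0ℚ ≤ ∥ z ∥
0≤∥∥ (a +i b) = 0≤+ (ℚ.0≤∣p∣ a) (ℚ.0≤∣p∣ b)

∥⊕∥ : ∀ z w → ∥ z ⊕ w ∥ ≤ ∥ z ∥ + ∥ w ∥
∥⊕∥ (a +i b) (c +i d) = begin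
  ∣ a + c ∣ + ∣ b + d ∣
    ≤⟨ ℚ.+-mono-≤ (ℚ.∣p+q∣≤∣p∣+∣q∣ a c) (ℚ.∣p+q∣≤∣p∣+∣q∣ b d) ⟩
  (∣ a ∣ + ∣ c ∣) + (∣ b ∣ + ∣ d ∣)
    ≡⟨ solve 4 (λ a b c d → (a :+ c) :+ (b :+ d) := (a :+ b) :+ (c :+ d))
         refl (∣ a ∣) (∣ b ∣) (∣ c ∣) (∣ d ∣) ⟩
  (∣ a ∣ + ∣ b ∣) + (∣ c ∣ + ∣ d ∣) ∎

∥⊗∥ : ∀ z w → ∥ z ⊗ w ∥ ≤ ∥ z ∥ * ∥ w ∥
∥⊗∥ (a +i b) (c +i d) = begin
  ∣ a * c - b * d ∣ + ∣ a * d + b * c ∣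
    ≤⟨ ℚ.+-mono-≤ (ℚ.∣p-q∣≤∣p∣+∣q∣ (a * c) (b * d))
                  (ℚ.∣p+q∣≤∣p∣+∣q∣ (a * d) (b * c)) ⟩
  (∣ a * c ∣ + ∣ b * d ∣) + (∣ a * d ∣ + ∣ b * c ∣)
    ≡⟨ cong₂ _+_ (cong₂ _+_ (ℚ.∣p*q∣≡∣p∣*∣q∣ a c) (ℚ.∣p*q∣≡∣p∣*∣q∣ b d))
                 (cong₂ _+_ (ℚ.∣p*q∣≡∣p∣*∣q∣ a d) (ℚ.∣p*q∣≡∣p∣*∣q∣ b c)) ⟩
  (∣ a ∣ * ∣ c ∣ + ∣ b ∣ * ∣ d ∣) + (∣ a ∣ * ∣ d ∣ + ∣ b ∣ * ∣ c ∣)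
    ≡⟨ solve 4 (λ a b c d → (a :* c :+ b :* d) :+ (a :* d :+ b :* c)
                          := (a :+ b) :* (c :+ d))
         refl (∣ a ∣) (∣ b ∣) (∣ c ∣) (∣ d ∣) ⟩
  (∣ a ∣ + ∣ b ∣) * (∣ c ∣ + ∣ d ∣) ∎

∥•∥ : ∀ r z → ∥ r • z ∥ ≡ ∣ r ∣ * ∥ z ∥
∥•∥ r (a +i b) = trans
  (cong₂ _+_ (ℚ.∣p*q∣≡∣p∣*∣q∣ r a) (ℚ.∣p*q∣≡∣p∣*∣q∣ r b))
  (sym (ℚ.*-distribˡ-+ (∣ r ∣) (∣ a ∣) (∣ b ∣)))

∥⊖∥-sym : ∀ z w → ∥ z ⊖ w ∥ ≡ ∥ w ⊖ z ∥
∥⊖∥-sym (a +i b) (c +i d) = cong₂ _+_ (lem a c) (lem b d)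
  where
  lem : ∀ x y → ∣ x - y ∣ ≡ ∣ y - x ∣
  lem x y = trans (cong ∣_∣ (solve 2 (λ x y → x :- y := :- (y :- x)) refl x y))
                  (ℚ.∣-p∣≡∣p∣ (y - x))

∥⊖∥-self : ∀ z → ∥ z ⊖ z ∥ ≡ 0ℚ
∥⊖∥-self (a +i b) =
  cong₂ _+_ (lem a) (lem b)
  where
  lem : ∀ a → ∣ a - a ∣ ≡ 0ℚ
  lem a = cong ∣_∣ (ℚ.+-inverseʳ a)

∥⊖∥-triangle : ∀ x y z → ∥ x ⊖ z ∥ ≤ ∥ x ⊖ y ∥ + ∥ y ⊖ z ∥
∥⊖∥-triangle x y z = ℚ.≤-trans (ℚ.≤-reflexive (cong ∥_∥ (split x y z))) (∥⊕∥ (x ⊖ y) (y ⊖ z))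
  where
  lem : ∀ a b c → a - c ≡ (a - b) + (b - c)
  lem = solve 3 (λ a b c → a :- c := (a :- b) :+ (b :- c)) refl
  split : ∀ x y z → x ⊖ z ≡ (x ⊖ y) ⊕ (y ⊖ z)
  split (a +i b) (c +i d) (e +i f) = cong₂ _+i_ (lem a c e) (lem b d f)

∥∥≤ : ∀ z w → ∥ z ∥ ≤ ∥ z ⊖ w ∥ + ∥ w ∥
∥∥≤ z w = ℚ.≤-trans (ℚ.≤-reflexive (cong ∥_∥ (split z w))) (∥⊕∥ (z ⊖ w) w)
  where
  lem : ∀ a b → a ≡ (a - b) + b
  lem = solve 2 (λ a b → a := (a :- b) :+ b) refl
  split : ∀ z w → z ≡ (z ⊖ w) ⊕ w
  split (a +i b) (c +i d) = cong₂ _+i_ (lem a c) (lem b d)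

⊕-⊖-⊕ : ∀ x y z w → (x ⊕ y) ⊖ (z ⊕ w) ≡ (x ⊖ z) ⊕ (y ⊖ w)
⊕-⊖-⊕ (a +i b) (c +i d) (e +i f) (g +i h) = cong₂ _+i_ (lem a c e g) (lem b d f h)
  where
  lem : ∀ a c e g → (a + c) - (e + g) ≡ (a - e) + (c - g)
  lem = solve 4 (λ a c e g → (a :+ c) :- (e :+ g) := (a :- e) :+ (c :- g)) refl

⊗-⊖-⊗ : ∀ x y z w → (x ⊗ y) ⊖ (z ⊗ w) ≡ (x ⊗ (y ⊖ w)) ⊕ ((x ⊖ z) ⊗ w)
⊗-⊖-⊗ (a +i b) (c +i d) (e +i f) (g +i h) = cong₂ _+i_
  (solve 8 (λ a b c d e f g h →
     (a :* c :- b :* d) :- (e :* g :- f :* h)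
     := (a :* (c :- g) :- b :* (d :- h)) :+ ((a :- e) :* g :- (b :- f) :* h))
     refl a b c d e f g h)
  (solve 8 (λ a b c d e f g h →
     (a :* d :+ b :* c) :- (e :* h :+ f :* g)
     := (a :* (d :- h) :+ b :* (c :- g)) :+ ((a :- e) :* h :+ (b :- f) :* g))
     refl a b c d e f g h)

∥⊗⊖⊗∥ : ∀ x y z w → ∥ x ⊗ y ⊖ z ⊗ w ∥ ≤ ∥ x ∥ * ∥ y ⊖ w ∥ + ∥ x ⊖ z ∥ * ∥ w ∥
∥⊗⊖⊗∥ x y z w = begin
  ∥ x ⊗ y ⊖ z ⊗ w ∥                        ≡⟨ cong ∥_∥ (⊗-⊖-⊗ x y z w) ⟩
  ∥ x ⊗ (y ⊖ w) ⊕ (x ⊖ z) ⊗ w ∥            ≤⟨ ∥⊕∥ (x ⊗ (y ⊖ w)) ((x ⊖ z) ⊗ w) ⟩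
  ∥ x ⊗ (y ⊖ w) ∥ + ∥ (x ⊖ z) ⊗ w ∥        ≤⟨ ℚ.+-mono-≤ (∥⊗∥ x (y ⊖ w)) (∥⊗∥ (x ⊖ z) w) ⟩
  ∥ x ∥ * ∥ y ⊖ w ∥ + ∥ x ⊖ z ∥ * ∥ w ∥    ∎

•-⊖ : ∀ r z w → r • z ⊖ r • w ≡ r • (z ⊖ w)
•-⊖ r (a +i b) (c +i d) = cong₂ _+i_ (lem r a c) (lem r b d)
  where
  lem : ∀ r a c → r * a - r * c ≡ r * (a - c)
  lem = solve 3 (λ r a c → r :* a :- r :* c := r :* (a :- c)) refl

natℚ : ℕ → ℚ
natℚ n = + n / 1

recip : ℕ → ℚ
recip n = + 1 / suc n

toℚᵘ-/ : ∀ p n → ℚ.toℚᵘ (p / suc n) ≃ mkℚᵘ p n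
toℚᵘ-/ p n = ℚ.toℚᵘ-fromℚᵘ (mkℚᵘ p n)

natℚ-suc : ∀ n → natℚ (suc n) ≡ natℚ n + 1ℚ
natℚ-suc n = ℚ.toℚᵘ-injective
  (ℚᵘ.≃-trans (toℚᵘ-/ (+ suc n) 0)
  (ℚᵘ.≃-trans (*≡* eq)
  (ℚᵘ.≃-sym (ℚᵘ.≃-trans (ℚ.toℚᵘ-homo-+ (natℚ n) 1ℚ)
                        (ℚᵘ.+-cong (toℚᵘ-/ (+ n) 0) ℚᵘ.≃-refl)))))
  where
  eq : + suc n ℤ.* + 1 ≡ (+ n ℤ.* + 1 ℤ.+ + 1 ℤ.* + 1) ℤ.* + 1
  eq = cong (ℤ._* + 1) (trans (cong +_ (ℕ.+-comm 1 n))
                              (cong (ℤ._+ + 1) (sym (ℤ.*-identityʳ (+ n)))))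

0≤natℚ : ∀ n → 0ℚ ≤ natℚ n
0≤natℚ n = ℚ.nonNegative⁻¹ (natℚ n) {{ℚ.normalize-nonNeg n 1}}

0<natℚ : ∀ n → 0ℚ < natℚ (suc n)
0<natℚ n = ℚ.positive⁻¹ (natℚ (suc n)) {{ℚ.normalize-pos (suc n) 1}}

0≤recip : ∀ n → 0ℚ ≤ recip n
0≤recip n = ℚ.nonNegative⁻¹ (recip n) {{ℚ.normalize-nonNeg 1 (suc n)}}

recip-inverse : ∀ n → recip n * natℚ (suc n) ≡ 1ℚ
recip-inverse n = ℚ.toℚᵘ-injective
  (ℚᵘ.≃-trans (ℚ.toℚᵘ-homo-* (recip n) (natℚ (suc n)))
  (ℚᵘ.≃-trans (ℚᵘ.*-cong (toℚᵘ-/ (+ 1) n) (toℚᵘ-/ (+ suc n) 0))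
  (*≡* eq)))
  where
  eq : (+ 1 ℤ.* + suc n) ℤ.* + 1 ≡ + 1 ℤ.* (+ suc n ℤ.* + 1)
  eq = ℤ.*-assoc (+ 1) (+ suc n) (+ 1)

natℚ-mono : ∀ {m n} → m ℕ.≤ n → natℚ m ≤ natℚ n
natℚ-mono {n = n} z≤n = 0≤natℚ n
natℚ-mono (s≤s {m} {n} m≤n) = begin
  natℚ (suc m)  ≡⟨ natℚ-suc m ⟩
  natℚ m + 1ℚ   ≤⟨ ℚ.+-monoˡ-≤ 1ℚ (natℚ-mono m≤n) ⟩
  natℚ n + 1ℚ   ≡⟨ natℚ-suc n ⟨
  natℚ (suc n)  ∎

archimedean : ∀ q → ∃ λ n → q ≤ natℚ n
archimedean q@(ℚ.mkℚ a d _) = ℤ.∣ a ∣ , ℚ.toℚᵘ-cancel-≤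
  (ℚᵘ.≤-trans (*≤* le) (ℚᵘ.≤-reflexive (ℚᵘ.≃-sym (toℚᵘ-/ (+ ℤ.∣ a ∣) 0))))
  where
  le : a ℤ.* + 1 ℤ.≤ + ℤ.∣ a ∣ ℤ.* + suc d
  le = ℤ.≤-trans (ℤ.≤-reflexive (ℤ.*-identityʳ a))
      (ℤ.≤-trans (≤abs a)
      (subst (+ ℤ.∣ a ∣ ℤ.≤_) (ℤ.pos-* ℤ.∣ a ∣ (suc d))
        (ℤ.+≤+ (ℕ.m≤m*n ℤ.∣ a ∣ (suc d)))))
    where
    ≤abs : ∀ a → a ℤ.≤ + ℤ.∣ a ∣
    ≤abs (+ n) = ℤ.≤-refl
    ≤abs (ℤ.-[1+ n ]) = ℤ.-≤+

4/5 : ℚ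
4/5 = + 4 / 5

pow : ℕ → ℚ
pow zero    = 1ℚ
pow (suc n) = 4/5 * pow n

0≤pow : ∀ n → 0ℚ ≤ pow n
0≤pow zero    = 0≤1
0≤pow (suc n) = 0≤* (from-yes (0ℚ ≤? 4/5)) (0≤pow n)

pow-bound : ∀ n → natℚ (4 ℕ.+ n) * pow n ≤ natℚ 4
pow-bound zero    = ℚ.≤-reflexive refl
pow-bound (suc n) = begin
  natℚ (5 ℕ.+ n) * (4/5 * p)
    ≡⟨ cong (_* (4/5 * p)) (natℚ-suc (4 ℕ.+ n)) ⟩
  (N + 1ℚ) * (4/5 * p)
    ≡⟨ solve 2 (λ N p → (N :+ con 1ℚ) :* (con 4/5 :* p)
                     := con 4/5 :* ((con 1ℚ :+ N) :* p)) refl N p ⟩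
  4/5 * ((1ℚ + N) * p)
    ≤⟨ *-monoʳ (from-yes (0ℚ ≤? 4/5)) (*-monoˡ (0≤pow n) (ℚ.+-monoˡ-≤ N 1≤N/4)) ⟩
  4/5 * ((+ 1 / 4 * N + N) * p)
    ≡⟨ solve 2 (λ N p → con 4/5 :* ((con (+ 1 / 4) :* N :+ N) :* p) := N :* p) refl N p ⟩
  N * p
    ≤⟨ pow-bound n ⟩
  natℚ 4 ∎
  where
  p = pow n
  N = natℚ (4 ℕ.+ n)
  1≤N/4 : 1ℚ ≤ + 1 / 4 * N
  1≤N/4 = *-monoʳ {c = + 1 / 4} (from-yes (0ℚ ≤? + 1 / 4)) (natℚ-mono (ℕ.m≤m+n 4 n))

pow-small : ∀ K ε → 0ℚ ≤ K → 0ℚ < ε → ∃ λ N → ∀ n → N ℕ.≤ n → K * pow n < ε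
pow-small K ε 0≤K 0<ε = N , bound
  where
  instance
    ε-pos : ℚ.Positive ε
    ε-pos = ℚ.positive 0<ε
    ε-nz : ℚ.NonZero ε
    ε-nz = ℚ.>-nonZero 0<ε
  0≤ε = ℚ.<⇒≤ 0<ε
  L = natℚ 4 * K * (ℚ.1/ ε)
  N = proj₁ (archimedean L)
  4K≤ : natℚ 4 * K ≤ natℚ N * ε
  4K≤ = begin
    natℚ 4 * K                    ≡⟨ ℚ.*-identityʳ _ ⟨
    natℚ 4 * K * 1ℚ               ≡⟨ cong (natℚ 4 * K *_) (ℚ.*-inverseˡ ε) ⟨
    natℚ 4 * K * ((ℚ.1/ ε) * ε)   ≡⟨ ℚ.*-assoc (natℚ 4 * K) (ℚ.1/ ε) ε ⟨
    L * ε                         ≤⟨ *-monoˡ 0≤ε (proj₂ (archimedean L)) ⟩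
    natℚ N * ε                    ∎
  bound : ∀ n → N ℕ.≤ n → K * pow n < ε
  bound n N≤n = ℚ.*-cancelˡ-<-nonNeg (natℚ (suc (3 ℕ.+ n)))
    {{ℚ.normalize-nonNeg (suc (3 ℕ.+ n)) 1}} (begin-strict
    natℚ (4 ℕ.+ n) * (K * pow n)
      ≡⟨ solve 3 (λ n K p → n :* (K :* p) := K :* (n :* p)) refl (natℚ (4 ℕ.+ n)) K (pow n) ⟩
    K * (natℚ (4 ℕ.+ n) * pow n)
      ≤⟨ *-monoʳ 0≤K (pow-bound n) ⟩
    K * natℚ 4
      ≡⟨ ℚ.*-comm K (natℚ 4) ⟩
    natℚ 4 * K
      ≤⟨ 4K≤ ⟩
    natℚ N * ε
      ≤⟨ *-monoˡ 0≤ε (natℚ-mono (ℕ.≤-trans N≤n (ℕ.m≤n+m n 3))) ⟩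
    natℚ (3 ℕ.+ n) * ε
      <⟨ ℚ.*-monoˡ-<-pos ε (lt (3 ℕ.+ n)) ⟩
    natℚ (4 ℕ.+ n) * ε ∎)
    where
    lt : ∀ k → natℚ k < natℚ (suc k)
    lt k = begin-strict
      natℚ k        ≡⟨ ℚ.+-identityʳ (natℚ k) ⟨
      natℚ k + 0ℚ   <⟨ ℚ.+-monoʳ-< (natℚ k) (from-yes (0ℚ <? 1ℚ)) ⟩
      natℚ k + 1ℚ   ≡⟨ natℚ-suc k ⟨
      natℚ (suc k)  ∎

-- The Cauchy completion of ℚ[i]; real and imaginary parts of such sequences are
-- exactly the Cauchy sequences of rationals.
record ℂ : Set where
  no-eta-equality
  field
    seq    : ℕ → ℚ[i]
    cauchy : ∀ ε → 0ℚ < ε →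
             ∃ λ N → ∀ m n → N ℕ.≤ m → N ℕ.≤ n → ∥ seq m ⊖ seq n ∥ < ε
open ℂ public

infix 4 _≈_
_≈_ : ℂ → ℂ → Set
x ≈ y = ∀ ε → 0ℚ < ε → ∃ λ N → ∀ n → N ℕ.≤ n → ∥ seq x n ⊖ seq y n ∥ < ε

shrink : ∀ K ε → 0ℚ ≤ K → 0ℚ < ε → ∃ λ δ → 0ℚ < δ × K * δ < ε
shrink K ε 0≤K 0<ε = ε * L , 0<δ , (begin-strict
  K * (ε * L)         <⟨ ≤-<+ (K * (ε * L)) 0<δ ⟩
  K * (ε * L) + ε * L
    ≡⟨ solve 3 (λ K e L → K :* (e :* L) :+ e :* L := e :* (L :* (K :+ con 1ℚ))) refl K ε L ⟩
  ε * (L * (K + 1ℚ))  ≡⟨ cong (ε *_) (ℚ.*-inverseˡ (K + 1ℚ)) ⟩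
  ε * 1ℚ              ≡⟨ ℚ.*-identityʳ ε ⟩
  ε                   ∎)
  where
  instance
    pos : ℚ.Positive (K + 1ℚ)
    pos = ℚ.positive (ℚ.+-mono-≤-< 0≤K (from-yes (0ℚ <? 1ℚ)))
    nz : ℚ.NonZero (K + 1ℚ)
    nz = ℚ.pos⇒nonZero (K + 1ℚ)
  L = ℚ.1/ (K + 1ℚ)
  ≤-<+ : ∀ a {b} → 0ℚ < b → a < a + b
  ≤-<+ a {b} 0<b = subst (_< a + b) (ℚ.+-identityʳ a) (ℚ.+-monoʳ-< a 0<b)
  0<δ : 0ℚ < ε * L
  0<δ = subst (_< ε * L) (ℚ.*-zeroʳ ε)
    (ℚ.*-monoʳ-<-pos ε {{ℚ.positive 0<ε}} (ℚ.positive⁻¹ L {{ℚ.1/pos⇒pos (K + 1ℚ)}}))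

-- u is Cauchy if its increments are controlled by those of x and y
cauchy-from : ∀ (x y : ℂ) (u : ℕ → ℚ[i]) K → 0ℚ ≤ K →
  (∀ m n → ∥ u m ⊖ u n ∥ ≤ K * ∥ seq x m ⊖ seq x n ∥ + K * ∥ seq y m ⊖ seq y n ∥) →
  ∀ ε → 0ℚ < ε → ∃ λ N → ∀ m n → N ℕ.≤ m → N ℕ.≤ n → ∥ u m ⊖ u n ∥ < ε
cauchy-from x y u K 0≤K h ε 0<ε = choose-δ (shrink (K + K) ε (0≤+ 0≤K 0≤K) 0<ε)
  where
  CauchyAt : (ℕ → ℚ[i]) → ℚ → Set
  CauchyAt v ε = ∃ λ N → ∀ m n → N ℕ.≤ m → N ℕ.≤ n → ∥ v m ⊖ v n ∥ < ε

  module _ {δ} (Kδ<ε : (K + K) * δ < ε) where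
    choose-N : CauchyAt (seq x) δ → CauchyAt (seq y) δ → CauchyAt u ε
    choose-N (N , hx) (M , hy) = N ℕ.⊔ M , λ m n N≤m N≤n → begin-strict
      ∥ u m ⊖ u n ∥
        ≤⟨ h m n ⟩
      K * ∥ seq x m ⊖ seq x n ∥ + K * ∥ seq y m ⊖ seq y n ∥
        ≤⟨ ℚ.+-mono-≤
             (*-monoʳ 0≤K (ℚ.<⇒≤ (hx m n (ℕ.m⊔n≤o⇒m≤o N M N≤m) (ℕ.m⊔n≤o⇒m≤o N M N≤n))))
             (*-monoʳ 0≤K (ℚ.<⇒≤ (hy m n (ℕ.m⊔n≤o⇒n≤o N M N≤m) (ℕ.m⊔n≤o⇒n≤o N M N≤n)))) ⟩
      K * δ + K * δ
        ≡⟨ ℚ.*-distribʳ-+ δ K K ⟨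
      (K + K) * δ
        <⟨ Kδ<ε ⟩
      ε ∎

  choose-δ : (∃ λ δ → 0ℚ < δ × (K + K) * δ < ε) → CauchyAt u ε
  choose-δ (δ , 0<δ , Kδ<ε) = choose-N Kδ<ε (cauchy x δ 0<δ) (cauchy y δ 0<δ)

bounded : ∀ (x : ℂ) → ∃ λ B → 0ℚ ≤ B × (∀ n → ∥ seq x n ∥ ≤ B)
bounded x = choose-N (cauchy x 1ℚ (from-yes (0ℚ <? 1ℚ)))
  where
  -- the sum of the first n norms bounds each of them
  P : ℕ → ℚ
  P zero    = 0ℚ
  P (suc n) = P n + ∥ seq x n ∥
  0≤P : ∀ n → 0ℚ ≤ P n
  0≤P zero    = ℚ.≤-refl
  0≤P (suc n) = 0≤+ (0≤P n) (0≤∥∥ (seq x n))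
  in-P : ∀ {n M} → n ℕ.<′ M → ∥ seq x n ∥ ≤ P M
  in-P {n} ℕ.<′-base       = ≤+ˡ (0≤P n)
  in-P (ℕ.<′-step {M} n<M) = ℚ.≤-trans (in-P n<M) (≤+ʳ (0≤∥∥ (seq x M)))

  module _ (N : ℕ) (h : ∀ n → N ℕ.≤ n → ∥ seq x n ⊖ seq x N ∥ < 1ℚ) where
    T = 1ℚ + ∥ seq x N ∥
    0≤T : 0ℚ ≤ T
    0≤T = 0≤+ 0≤1 (0≤∥∥ (seq x N))
    bound : ∀ n → n ℕ.< N ⊎ N ℕ.≤ n → ∥ seq x n ∥ ≤ P N + T
    bound n (inj₁ n<N) = ℚ.≤-trans (in-P (ℕ.<⇒<′ n<N)) (≤+ʳ 0≤T)
    bound n (inj₂ N≤n) = begin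
      ∥ seq x n ∥                          ≤⟨ ∥∥≤ (seq x n) (seq x N) ⟩
      ∥ seq x n ⊖ seq x N ∥ + ∥ seq x N ∥
        ≤⟨ ℚ.+-monoˡ-≤ (∥ seq x N ∥) (ℚ.<⇒≤ (h n N≤n)) ⟩
      T                                    ≤⟨ ≤+ˡ (0≤P N) ⟩
      P N + T                              ∎

  choose-N : (∃ λ N → ∀ m n → N ℕ.≤ m → N ℕ.≤ n → ∥ seq x m ⊖ seq x n ∥ < 1ℚ) →
             ∃ λ B → 0ℚ ≤ B × (∀ n → ∥ seq x n ∥ ≤ B)
  choose-N (N , h) = P N + T N h′ , 0≤+ (0≤P N) (0≤T N h′) ,
                     λ n → bound N h′ n (ℕ.<-≤-connex n N)
    where
    h′ : ∀ n → N ℕ.≤ n → ∥ seq x n ⊖ seq x N ∥ < 1ℚ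
    h′ n N≤n = h n N N≤n ℕ.≤-refl

-- it suffices to compare the later with the earlier term
from-ordered : ∀ (u : ℕ → ℚ[i]) {N ε} →
  (∀ j n → N ℕ.≤ n → ∥ u (j ℕ.+ n) ⊖ u n ∥ < ε) →
  ∀ m n → N ℕ.≤ m → N ℕ.≤ n → ∥ u m ⊖ u n ∥ < ε
from-ordered u {N} {ε} h m n N≤m N≤n = cases (ℕ.≤-total n m)
  where
  cases : n ℕ.≤ m ⊎ m ℕ.≤ n → ∥ u m ⊖ u n ∥ < ε
  cases (inj₁ n≤m) = subst (λ k → ∥ u k ⊖ u n ∥ < ε) (ℕ.m∸n+n≡m n≤m) (h (m ℕ.∸ n) n N≤n)
  cases (inj₂ m≤n) = subst (_< ε) (∥⊖∥-sym (u n) (u m))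
    (subst (λ k → ∥ u k ⊖ u m ∥ < ε) (ℕ.m∸n+n≡m m≤n) (h (n ℕ.∸ m) m N≤m))

const : ℚ[i] → ℂ
const z .seq _ = z
const z .cauchy ε 0<ε = 0 , λ _ _ _ _ → subst (_< ε) (sym (∥⊖∥-self z)) 0<ε

fromℚ : ℚ → ℂ
fromℚ q = const (q +i 0ℚ)

0ᶜ 1ᶜ i : ℂ
0ᶜ = const 0ᵍ
1ᶜ = const 1ᵍ
i  = const iᵍ

infixl 6 _+ᶜ_
infixl 7 _*ᶜ_

_+ᶜ_ : ℂ → ℂ → ℂ
(x +ᶜ y) .seq n = seq x n ⊕ seq y n
(x +ᶜ y) .cauchy = cauchy-from x y (λ n → seq x n ⊕ seq y n) 1ℚ 0≤1 λ m n → begin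
  ∥ (seq x m ⊕ seq y m) ⊖ (seq x n ⊕ seq y n) ∥
    ≡⟨ cong ∥_∥ (⊕-⊖-⊕ (seq x m) (seq y m) (seq x n) (seq y n)) ⟩
  ∥ (seq x m ⊖ seq x n) ⊕ (seq y m ⊖ seq y n) ∥
    ≤⟨ ∥⊕∥ (seq x m ⊖ seq x n) (seq y m ⊖ seq y n) ⟩
  ∥ seq x m ⊖ seq x n ∥ + ∥ seq y m ⊖ seq y n ∥
    ≡⟨ cong₂ _+_ (ℚ.*-identityˡ ∥ seq x m ⊖ seq x n ∥) (ℚ.*-identityˡ ∥ seq y m ⊖ seq y n ∥) ⟨
  1ℚ * ∥ seq x m ⊖ seq x n ∥ + 1ℚ * ∥ seq y m ⊖ seq y n ∥ ∎

_*ᶜ_ : ℂ → ℂ → ℂ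
(x *ᶜ y) .seq n = seq x n ⊗ seq y n
(x *ᶜ y) .cauchy = choose-bounds (bounded x) (bounded y)
  where
  Bounded : ℂ → Set
  Bounded z = ∃ λ B → 0ℚ ≤ B × (∀ n → ∥ seq z n ∥ ≤ B)
  choose-bounds : Bounded x → Bounded y → ∀ ε → 0ℚ < ε → ∃ λ N →
    ∀ m n → N ℕ.≤ m → N ℕ.≤ n → ∥ seq x m ⊗ seq y m ⊖ seq x n ⊗ seq y n ∥ < ε
  choose-bounds (B , 0≤B , hB) (C , 0≤C , hC) =
   cauchy-from x y (λ n → seq x n ⊗ seq y n) (B + C) (0≤+ 0≤B 0≤C) λ m n → begin
    ∥ seq x m ⊗ seq y m ⊖ seq x n ⊗ seq y n ∥
      ≤⟨ ∥⊗⊖⊗∥ (seq x m) (seq y m) (seq x n) (seq y n) ⟩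
    ∥ seq x m ∥ * ∥ seq y m ⊖ seq y n ∥ + ∥ seq x m ⊖ seq x n ∥ * ∥ seq y n ∥
      ≡⟨ ℚ.+-comm (∥ seq x m ∥ * ∥ seq y m ⊖ seq y n ∥) _ ⟩
    ∥ seq x m ⊖ seq x n ∥ * ∥ seq y n ∥ + ∥ seq x m ∥ * ∥ seq y m ⊖ seq y n ∥
      ≡⟨ cong (_+ ∥ seq x m ∥ * ∥ seq y m ⊖ seq y n ∥) (ℚ.*-comm ∥ seq x m ⊖ seq x n ∥ ∥ seq y n ∥) ⟩
    ∥ seq y n ∥ * ∥ seq x m ⊖ seq x n ∥ + ∥ seq x m ∥ * ∥ seq y m ⊖ seq y n ∥
      ≤⟨ ℚ.+-mono-≤
           (*-monoˡ (0≤∥∥ (seq x m ⊖ seq x n)) (ℚ.≤-trans (hC n) (≤+ˡ 0≤B)))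
           (*-monoˡ (0≤∥∥ (seq y m ⊖ seq y n)) (ℚ.≤-trans (hB m) (≤+ʳ 0≤C))) ⟩
    (B + C) * ∥ seq x m ⊖ seq x n ∥ + (B + C) * ∥ seq y m ⊖ seq y n ∥ ∎

-- z ^ k / k !
term : ℕ → ℚ[i] → ℚ[i]
term zero    z = 1ᵍ
term (suc k) z = recip k • (z ⊗ term k z)

-- the sum of z ^ k / k ! over 0 ≤ k ≤ n
partial : ℕ → ℚ[i] → ℚ[i]
partial zero    z = term zero z
partial (suc n) z = partial n z ⊕ term (suc n) z

-- B ^ k / k ! and its sum over 0 ≤ k < n
t : ℚ → ℕ → ℚ
t B zero    = 1ℚ
t B (suc k) = recip k * (B * t B k)

s : ℚ → ℕ → ℚ
s B zero    = 0ℚ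
s B (suc n) = s B n + t B n

recip-• : ∀ k z → ∥ recip k • z ∥ ≡ recip k * ∥ z ∥
recip-• k z = trans (∥•∥ (recip k) z) (cong (_* ∥ z ∥) (ℚ.0≤p⇒∣p∣≡p (0≤recip k)))

module _ {B : ℚ} (0≤B : 0ℚ ≤ B) where

  0≤t : ∀ k → 0ℚ ≤ t B k
  0≤t zero    = 0≤1
  0≤t (suc k) = 0≤* (0≤recip k) (0≤* 0≤B (0≤t k))

  0≤s : ∀ n → 0ℚ ≤ s B n
  0≤s zero    = ℚ.≤-refl
  0≤s (suc n) = 0≤+ (0≤s n) (0≤t n)

  t-suc : ∀ k → natℚ (suc k) * t B (suc k) ≡ B * t B k
  t-suc k = trans
    (solve 4 (λ n r B t → n :* (r :* (B :* t)) := (r :* n) :* (B :* t))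
       refl (natℚ (suc k)) (recip k) B (t B k))
    (trans (cong (_* (B * t B k)) (recip-inverse k)) (ℚ.*-identityˡ (B * t B k)))

  term-bound : ∀ k {z} → ∥ z ∥ ≤ B → ∥ term k z ∥ ≤ t B k
  term-bound zero        h = ℚ.≤-reflexive refl
  term-bound (suc k) {z} h = begin
    ∥ recip k • (z ⊗ term k z) ∥      ≡⟨ recip-• k (z ⊗ term k z) ⟩
    recip k * ∥ z ⊗ term k z ∥        ≤⟨ *-monoʳ (0≤recip k) (∥⊗∥ z (term k z)) ⟩
    recip k * (∥ z ∥ * ∥ term k z ∥)
      ≤⟨ *-monoʳ (0≤recip k) (*-mono (0≤∥∥ z) (0≤t k) h (term-bound k h)) ⟩
    recip k * (B * t B k)             ∎

  module _ {z w : ℚ[i]} (hz : ∥ z ∥ ≤ B) (hw : ∥ w ∥ ≤ B) where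

    private d = ∥ z ⊖ w ∥

    term-lipschitz : ∀ k → ∥ term (suc k) z ⊖ term (suc k) w ∥ ≤ d * t B k
    term-lipschitz k = begin
      ∥ recip k • (z ⊗ term k z) ⊖ recip k • (w ⊗ term k w) ∥
        ≡⟨ cong ∥_∥ (•-⊖ (recip k) (z ⊗ term k z) (w ⊗ term k w)) ⟩
      ∥ recip k • (z ⊗ term k z ⊖ w ⊗ term k w) ∥
        ≡⟨ recip-• k (z ⊗ term k z ⊖ w ⊗ term k w) ⟩
      recip k * ∥ z ⊗ term k z ⊖ w ⊗ term k w ∥
        ≤⟨ *-monoʳ (0≤recip k) (∥⊗⊖⊗∥ z (term k z) w (term k w)) ⟩
      recip k * (∥ z ∥ * ∥ term k z ⊖ term k w ∥ + d * ∥ term k w ∥)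
        ≤⟨ *-monoʳ (0≤recip k) (ℚ.+-mono-≤ (previous k)
             (*-monoʳ (0≤∥∥ (z ⊖ w)) (term-bound k hw))) ⟩
      recip k * (natℚ k * (d * t B k) + d * t B k)
        ≡⟨ solve 3 (λ r n x → r :* (n :* x :+ x) := (r :* (n :+ con 1ℚ)) :* x)
             refl (recip k) (natℚ k) (d * t B k) ⟩
      recip k * (natℚ k + 1ℚ) * (d * t B k)
        ≡⟨ cong (λ n → recip k * n * (d * t B k)) (natℚ-suc k) ⟨
      recip k * natℚ (suc k) * (d * t B k)
        ≡⟨ cong (_* (d * t B k)) (recip-inverse k) ⟩
      1ℚ * (d * t B k)
        ≡⟨ ℚ.*-identityˡ (d * t B k) ⟩
      d * t B k ∎
      where
      previous : ∀ k → ∥ z ∥ * ∥ term k z ⊖ term k w ∥ ≤ natℚ k * (d * t B k)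
      previous zero = ℚ.≤-reflexive (trans (ℚ.*-zeroʳ ∥ z ∥) (sym (ℚ.*-zeroˡ (d * 1ℚ))))
      previous (suc k) = begin
        ∥ z ∥ * ∥ term (suc k) z ⊖ term (suc k) w ∥
          ≤⟨ *-mono (0≤∥∥ z) (0≤* (0≤∥∥ (z ⊖ w)) (0≤t k)) hz (term-lipschitz k) ⟩
        B * (d * t B k)
          ≡⟨ solve 3 (λ B d t → B :* (d :* t) := d :* (B :* t)) refl B d (t B k) ⟩
        d * (B * t B k)
          ≡⟨ cong (d *_) (t-suc k) ⟨
        d * (natℚ (suc k) * t B (suc k))
          ≡⟨ solve 3 (λ d n t → d :* (n :* t) := n :* (d :* t)) refl d (natℚ (suc k)) (t B (suc k)) ⟩
        natℚ (suc k) * (d * t B (suc k)) ∎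

    tail-lipschitz : ∀ n j →
      ∥ (partial (j ℕ.+ n) z ⊖ partial (j ℕ.+ n) w) ⊖ (partial n z ⊖ partial n w) ∥
      ≤ d * (s B (j ℕ.+ n) - s B n)
    tail-lipschitz n zero = ℚ.≤-reflexive (trans
      (∥⊖∥-self (partial n z ⊖ partial n w))
      (solve 2 (λ d s → con 0ℚ := d :* (s :- s)) refl d (s B n)))
    tail-lipschitz n (suc j) = begin
      ∥ (Pz ⊕ Tz ⊖ (Pw ⊕ Tw)) ⊖ D ∥
        ≡⟨ cong ∥_∥ (rearrange Pz Tz Pw Tw D) ⟩
      ∥ (Pz ⊖ Pw ⊖ D) ⊕ (Tz ⊖ Tw) ∥
        ≤⟨ ∥⊕∥ (Pz ⊖ Pw ⊖ D) (Tz ⊖ Tw) ⟩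
      ∥ Pz ⊖ Pw ⊖ D ∥ + ∥ Tz ⊖ Tw ∥
        ≤⟨ ℚ.+-mono-≤ (tail-lipschitz n j) (term-lipschitz (j ℕ.+ n)) ⟩
      d * (s B (j ℕ.+ n) - s B n) + d * t B (j ℕ.+ n)
        ≡⟨ solve 4 (λ d x y t → d :* (x :- y) :+ d :* t := d :* (x :+ t :- y))
             refl d (s B (j ℕ.+ n)) (s B n) (t B (j ℕ.+ n)) ⟩
      d * (s B (j ℕ.+ n) + t B (j ℕ.+ n) - s B n) ∎
      where
      Pz = partial (j ℕ.+ n) z
      Pw = partial (j ℕ.+ n) w
      Tz = term (suc (j ℕ.+ n)) z
      Tw = term (suc (j ℕ.+ n)) w
      D = partial n z ⊖ partial n w
      lem : ∀ a b c d e → a + b - (c + d) - e ≡ a - c - e + (b - d)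
      lem = solve 5 (λ a b c d e → a :+ b :- (c :+ d) :- e := a :- c :- e :+ (b :- d)) refl
      rearrange : ∀ a b c d e → ((a ⊕ b) ⊖ (c ⊕ d)) ⊖ e ≡ (a ⊖ c ⊖ e) ⊕ (b ⊖ d)
      rearrange (a +i a′) (b +i b′) (c +i c′) (d +i d′) (e +i e′) =
        cong₂ _+i_ (lem a b c d e) (lem a′ b′ c′ d′ e′)

    partial-lipschitz : ∀ n → ∥ partial n z ⊖ partial n w ∥ ≤ d * s B n
    partial-lipschitz zero    = ℚ.≤-reflexive (sym (ℚ.*-zeroʳ d))
    partial-lipschitz (suc n) = begin
      ∥ (partial n z ⊕ Tz) ⊖ (partial n w ⊕ Tw) ∥
        ≡⟨ cong ∥_∥ (⊕-⊖-⊕ (partial n z) Tz (partial n w) Tw) ⟩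
      ∥ (partial n z ⊖ partial n w) ⊕ (Tz ⊖ Tw) ∥
        ≤⟨ ∥⊕∥ (partial n z ⊖ partial n w) (Tz ⊖ Tw) ⟩
      ∥ partial n z ⊖ partial n w ∥ + ∥ Tz ⊖ Tw ∥
        ≤⟨ ℚ.+-mono-≤ (partial-lipschitz n) (term-lipschitz n) ⟩
      d * s B n + d * t B n
        ≡⟨ ℚ.*-distribˡ-+ d (s B n) (t B n) ⟨
      d * (s B n + t B n) ∎
      where
      Tz = term (suc n) z
      Tw = term (suc n) w

  partial-tail : ∀ n j {z} → ∥ z ∥ ≤ B →
    ∥ partial (j ℕ.+ n) z ⊖ partial n z ∥ ≤ s B (suc j ℕ.+ n) - s B (suc n)
  partial-tail n zero {z} h = ℚ.≤-reflexive (trans (∥⊖∥-self (partial n z))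
    (sym (ℚ.+-inverseʳ (s B (suc n)))))
  partial-tail n (suc j) {z} h = begin
    ∥ (P ⊕ T) ⊖ Q ∥
      ≡⟨ cong ∥_∥ (rearrange P T Q) ⟩
    ∥ (P ⊖ Q) ⊕ T ∥
      ≤⟨ ∥⊕∥ (P ⊖ Q) T ⟩
    ∥ P ⊖ Q ∥ + ∥ T ∥
      ≤⟨ ℚ.+-mono-≤ (partial-tail n j h) (term-bound (suc j ℕ.+ n) {z} h) ⟩
    s B (suc j ℕ.+ n) - s B (suc n) + t B (suc j ℕ.+ n)
      ≡⟨ lem (s B (suc j ℕ.+ n)) (t B (suc j ℕ.+ n)) (s B (suc n)) ⟨
    s B (suc j ℕ.+ n) + t B (suc j ℕ.+ n) - s B (suc n) ∎
    where
    P = partial (j ℕ.+ n) z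
    T = term (suc j ℕ.+ n) z
    Q = partial n z
    lem : ∀ a b c → a + b - c ≡ a - c + b
    lem = solve 3 (λ a b c → a :+ b :- c := a :- c :+ b) refl
    rearrange : ∀ a b c → (a ⊕ b) ⊖ c ≡ (a ⊖ c) ⊕ b
    rearrange (a +i a′) (b +i b′) (c +i c′) = cong₂ _+i_ (lem a b c) (lem a′ b′ c′)

  -- from the index N on, consecutive terms at least halve
  module _ (N : ℕ) (2B≤N : B + B ≤ natℚ N) where

    halving : ∀ {k} → N ℕ.≤ k → t B (suc k) + t B (suc k) ≤ t B k
    halving {k} N≤k = begin
      recip k * (B * t B k) + recip k * (B * t B k)
        ≡⟨ solve 3 (λ r B t → r :* (B :* t) :+ r :* (B :* t) := r :* (B :+ B) :* t)
             refl (recip k) B (t B k) ⟩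
      recip k * (B + B) * t B k
        ≤⟨ *-monoˡ (0≤t k) (*-monoʳ (0≤recip k)
             (ℚ.≤-trans 2B≤N (natℚ-mono (ℕ.m≤n⇒m≤1+n N≤k)))) ⟩
      recip k * natℚ (suc k) * t B k
        ≡⟨ cong (_* t B k) (recip-inverse k) ⟩
      1ℚ * t B k
        ≡⟨ ℚ.*-identityˡ (t B k) ⟩
      t B k ∎

    s-tail : ∀ {n} j → N ℕ.≤ n → s B (j ℕ.+ n) - s B n ≤ t B n + t B n
    s-tail {n} j N≤n = diff (U j)
      where
      U : ∀ j → s B (j ℕ.+ n) + (t B (j ℕ.+ n) + t B (j ℕ.+ n)) ≤ s B n + (t B n + t B n)
      U zero    = ℚ.≤-refl
      U (suc j) = begin
        s B k + t B k + (t B (suc k) + t B (suc k))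
          ≤⟨ ℚ.+-monoʳ-≤ (s B k + t B k) (halving (ℕ.≤-trans N≤n (ℕ.m≤n+m n j))) ⟩
        s B k + t B k + t B k
          ≡⟨ ℚ.+-assoc (s B k) (t B k) (t B k) ⟩
        s B k + (t B k + t B k)
          ≤⟨ U j ⟩
        s B n + (t B n + t B n) ∎
        where k = j ℕ.+ n
      diff : s B (j ℕ.+ n) + (t B (j ℕ.+ n) + t B (j ℕ.+ n)) ≤ s B n + (t B n + t B n) →
             s B (j ℕ.+ n) - s B n ≤ t B n + t B n
      diff h = begin
        s B (j ℕ.+ n) - s B n
          ≤⟨ ℚ.+-monoˡ-≤ (- s B n) (≤+ʳ {s B (j ℕ.+ n)} (0≤+ (0≤t (j ℕ.+ n)) (0≤t (j ℕ.+ n)))) ⟩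
        s B (j ℕ.+ n) + (t B (j ℕ.+ n) + t B (j ℕ.+ n)) - s B n
          ≤⟨ ℚ.+-monoˡ-≤ (- s B n) h ⟩
        s B n + (t B n + t B n) - s B n
          ≡⟨ solve 2 (λ s t → s :+ t :- s := t) refl (s B n) (t B n + t B n) ⟩
        t B n + t B n ∎

    t-decay : ∀ {n} j → N ℕ.≤ n → t B (j ℕ.+ n) ≤ t B n * pow j
    t-decay {n} zero    N≤n = ℚ.≤-reflexive (sym (ℚ.*-identityʳ (t B n)))
    t-decay {n} (suc j) N≤n = begin
      t B (suc k)
        ≡⟨ solve 1 (λ t → t := con ½ :* (t :+ t)) refl (t B (suc k)) ⟩
      ½ * (t B (suc k) + t B (suc k))
        ≤⟨ *-monoʳ (from-yes (0ℚ ≤? ½)) (halving (ℕ.≤-trans N≤n (ℕ.m≤n+m n j))) ⟩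
      ½ * t B k
        ≤⟨ *-monoˡ (0≤t k) (from-yes (½ ≤? 4/5)) ⟩
      4/5 * t B k
        ≤⟨ *-monoʳ (from-yes (0ℚ ≤? 4/5)) (t-decay j N≤n) ⟩
      4/5 * (t B n * pow j)
        ≡⟨ solve 3 (λ q t p → q :* (t :* p) := t :* (q :* p)) refl 4/5 (t B n) (pow j) ⟩
      t B n * (4/5 * pow j) ∎
      where k = j ℕ.+ n

    s-bounded : ∀ n → s B n ≤ s B N + (t B N + t B N)
    s-bounded n = cases (ℕ.≤-total n N)
      where
      s-mono : ∀ {m n} → m ℕ.≤′ n → s B m ≤ s B n
      s-mono ℕ.≤′-refl           = ℚ.≤-refl
      s-mono (ℕ.≤′-step {n} m≤n) = ℚ.≤-trans (s-mono m≤n) (≤+ʳ (0≤t n))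
      large : ∀ {n} o → o ℕ.+ N ≡ n → s B n ≤ s B N + (t B N + t B N)
      large o refl = begin
        s B (o ℕ.+ N)
          ≡⟨ solve 2 (λ a b → a := b :+ (a :- b)) refl (s B (o ℕ.+ N)) (s B N) ⟩
        s B N + (s B (o ℕ.+ N) - s B N)  ≤⟨ ℚ.+-monoʳ-≤ (s B N) (s-tail o ℕ.≤-refl) ⟩
        s B N + (t B N + t B N)          ∎
      cases : n ℕ.≤ N ⊎ N ℕ.≤ n → s B n ≤ s B N + (t B N + t B N)
      cases (inj₁ n≤N) = ℚ.≤-trans (s-mono (ℕ.≤⇒≤′ n≤N)) (≤+ʳ (0≤+ (0≤t N) (0≤t N)))
      cases (inj₂ N≤n) = large (n ℕ.∸ N) (ℕ.m∸n+n≡m N≤n)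

-- The n-th approximation truncates the series and approximates the argument
-- at the same time; the power series converges uniformly on bounded sets.
exp : ℂ → ℂ
exp x .seq n = partial n (seq x n)
exp x .cauchy ε 0<ε = choose-B (bounded x)
  where
  0<ε/2 : 0ℚ < ½ * ε
  0<ε/2 = ℚ.*-monoʳ-<-pos ½ 0<ε

  Goal : Set
  Goal = ∃ λ M → ∀ m n → M ℕ.≤ m → M ℕ.≤ n →
    ∥ partial m (seq x m) ⊖ partial n (seq x n) ∥ < ε

  module _ {B} (0≤B : 0ℚ ≤ B) (hB : ∀ n → ∥ seq x n ∥ ≤ B)
           {N} (2B≤N : B + B ≤ natℚ N) where
    T K : ℚ
    T = t B N + t B N
    K = s B N + T
    0≤T : 0ℚ ≤ T
    0≤T = 0≤+ (0≤t 0≤B N) (0≤t 0≤B N)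
    0≤K : 0ℚ ≤ K
    0≤K = 0≤+ (0≤s 0≤B N) 0≤T

    module _ {δ} (Kδ<ε/2 : K * δ < ½ * ε)
             {J} (hJ : ∀ n → J ℕ.≤ n → T * pow n < ½ * ε)
             {M} (hM : ∀ m n → M ℕ.≤ m → M ℕ.≤ n → ∥ seq x m ⊖ seq x n ∥ < δ) where

      argument : ∀ m n → M ℕ.≤ m → M ℕ.≤ n →
        ∥ partial m (seq x m) ⊖ partial m (seq x n) ∥ < ½ * ε
      argument m n M≤m M≤n = begin-strict
        ∥ partial m (seq x m) ⊖ partial m (seq x n) ∥
          ≤⟨ partial-lipschitz 0≤B (hB m) (hB n) m ⟩
        ∥ seq x m ⊖ seq x n ∥ * s B m
          ≤⟨ *-mono (0≤∥∥ (seq x m ⊖ seq x n)) 0≤K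
               (ℚ.<⇒≤ (hM m n M≤m M≤n)) (s-bounded 0≤B N 2B≤N m) ⟩
        δ * K
          ≡⟨ ℚ.*-comm δ K ⟩
        K * δ
          <⟨ Kδ<ε/2 ⟩
        ½ * ε ∎

      truncation : ∀ j k z → ∥ z ∥ ≤ B → J ℕ.≤ k →
        ∥ partial (j ℕ.+ (k ℕ.+ N)) z ⊖ partial (k ℕ.+ N) z ∥ ≤ ½ * ε
      truncation j k z hz J≤k = begin
        ∥ partial (j ℕ.+ n) z ⊖ partial n z ∥
          ≤⟨ partial-tail 0≤B n j hz ⟩
        s B (suc j ℕ.+ n) - s B (suc n)
          ≡⟨ cong (λ k → s B k - s B (suc n)) (ℕ.+-suc j n) ⟨
        s B (j ℕ.+ suc n) - s B (suc n)
          ≤⟨ s-tail 0≤B N 2B≤N j (ℕ.m≤n⇒m≤1+n (ℕ.m≤n+m N k)) ⟩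
        t B (suc n) + t B (suc n)
          ≤⟨ halving 0≤B N 2B≤N (ℕ.m≤n+m N k) ⟩
        t B n
          ≤⟨ t-decay 0≤B N 2B≤N k ℕ.≤-refl ⟩
        t B N * pow k
          ≤⟨ *-monoˡ (0≤pow k) (≤+ʳ {t B N} (0≤t 0≤B N)) ⟩
        T * pow k
          ≤⟨ ℚ.<⇒≤ (hJ k J≤k) ⟩
        ½ * ε ∎
        where n = k ℕ.+ N

      ordered : ∀ j k n → k ℕ.+ N ≡ n → J ℕ.≤ k → M ℕ.≤ n →
        ∥ partial (j ℕ.+ n) (seq x (j ℕ.+ n)) ⊖ partial n (seq x n) ∥ < ε
      ordered j k n refl J≤k M≤n = begin-strict
        ∥ partial m (seq x m) ⊖ partial n (seq x n) ∥
          ≤⟨ ∥⊖∥-triangle (partial m (seq x m)) (partial m (seq x n)) (partial n (seq x n)) ⟩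
        ∥ partial m (seq x m) ⊖ partial m (seq x n) ∥ + ∥ partial m (seq x n) ⊖ partial n (seq x n) ∥
          <⟨ ℚ.+-mono-<-≤ (argument m n (ℕ.≤-trans M≤n (ℕ.m≤n+m n j)) M≤n)
                          (truncation j k (seq x n) (hB n) J≤k) ⟩
        ½ * ε + ½ * ε
          ≡⟨ solve 1 (λ e → con ½ :* e :+ con ½ :* e := e) refl ε ⟩
        ε ∎
        where m = j ℕ.+ n

      goal : Goal
      goal = M ℕ.⊔ (J ℕ.+ N) , from-ordered (λ n → partial n (seq x n)) ordered′
        where
        ordered′ : ∀ j n → M ℕ.⊔ (J ℕ.+ N) ℕ.≤ n →
          ∥ partial (j ℕ.+ n) (seq x (j ℕ.+ n)) ⊖ partial n (seq x n) ∥ < ε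
        ordered′ j n h = ordered j (n ℕ.∸ N) n
          (ℕ.m∸n+n≡m (ℕ.≤-trans (ℕ.m≤n+m N J) J+N≤n)) (ℕ.m+n≤o⇒m≤o∸n J J+N≤n)
          (ℕ.m⊔n≤o⇒m≤o M (J ℕ.+ N) h)
          where J+N≤n = ℕ.m⊔n≤o⇒n≤o M (J ℕ.+ N) h

    choose-δ : (∃ λ δ → 0ℚ < δ × K * δ < ½ * ε) →
               (∃ λ J → ∀ n → J ℕ.≤ n → T * pow n < ½ * ε) → Goal
    choose-δ (δ , 0<δ , Kδ<ε/2) (J , hJ) =
      goal Kδ<ε/2 {J} hJ (proj₂ (cauchy x δ 0<δ))

    choose-both : Goal
    choose-both = choose-δ (shrink K (½ * ε) 0≤K 0<ε/2) (pow-small T (½ * ε) 0≤T 0<ε/2)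

  choose-B : (∃ λ B → 0ℚ ≤ B × (∀ n → ∥ seq x n ∥ ≤ B)) → Goal
  choose-B (B , 0≤B , hB) = choose-both 0≤B hB {proj₁ (archimedean (B + B))} (proj₂ (archimedean (B + B)))

-- the real part of the partial sums of exp (ix), hence those of cos x
cosₙ : ℕ → ℚ → ℚ
cosₙ n x = re (partial n (0ℚ +i x))

-- x ↦ x + cos x maps [7/5, 7/4] into itself and contracts it; its fixed point
-- there is π/2, the only zero of cos in that interval.  The iteration evaluates
-- cos with increasing precision.  half-π-step says that cosₙ (n + 5) (half-πₙ n)
-- is at most (4/5)ⁿ, so the limit is indeed a zero of cos.
half-πₙ : ℕ → ℚ
half-πₙ zero    = + 3 / 2
half-πₙ (suc n) = half-πₙ n + cosₙ (n ℕ.+ 5) (half-πₙ n)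

cos₅ : ℚ → ℚ
cos₅ x = 1ℚ - ½ * (x * x) + + 1 / 24 * (x * x * (x * x))

cos₅-correct : ∀ x → cosₙ 5 x ≡ cos₅ x
cos₅-correct x = trans (cong re (cong₂ _⊕_ (cong₂ _⊕_ (cong₂ _⊕_ (cong₂ _⊕_
    (cong (1ᵍ ⊕_) e₁) e₂) e₃) e₄) e₅))
  (solve 1 (λ x → con 1ℚ :+ con 0ℚ :+ con (- ½) :* (x :* x) :+ con 0ℚ
      :+ con (+ 1 / 24) :* (x :* x :* (x :* x)) :+ con 0ℚ
      := con 1ℚ :- con ½ :* (x :* x) :+ con (+ 1 / 24) :* (x :* x :* (x :* x)))
    refl x)
  where
  z = 0ℚ +i x
  step : ∀ k {a b c d} → term k z ≡ a +i b →
    recip k * (0ℚ * a - x * b) ≡ c → recip k * (0ℚ * b + x * a) ≡ d →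
    term (suc k) z ≡ c +i d
  step k h p q = trans (cong (λ w → recip k • (z ⊗ w)) h) (cong₂ _+i_ p q)
  e₁ : term 1 z ≡ 0ℚ +i x
  e₁ = step 0 refl
    (solve 1 (λ x → con 1ℚ :* (con 0ℚ :* con 1ℚ :- x :* con 0ℚ) := con 0ℚ) refl x)
    (solve 1 (λ x → con 1ℚ :* (con 0ℚ :* con 0ℚ :+ x :* con 1ℚ) := x) refl x)
  e₂ : term 2 z ≡ - ½ * (x * x) +i 0ℚ
  e₂ = step 1 e₁
    (solve 1 (λ x → con ½ :* (con 0ℚ :* con 0ℚ :- x :* x) := con (- ½) :* (x :* x)) refl x)
    (solve 1 (λ x → con ½ :* (con 0ℚ :* x :+ x :* con 0ℚ) := con 0ℚ) refl x)
  e₃ : term 3 z ≡ 0ℚ +i - (+ 1 / 6) * (x * x * x)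
  e₃ = step 2 e₂
    (solve 1 (λ x → con (+ 1 / 3) :* (con 0ℚ :* (con (- ½) :* (x :* x)) :- x :* con 0ℚ)
      := con 0ℚ) refl x)
    (solve 1 (λ x → con (+ 1 / 3) :* (con 0ℚ :* con 0ℚ :+ x :* (con (- ½) :* (x :* x)))
      := con (- (+ 1 / 6)) :* (x :* x :* x)) refl x)
  e₄ : term 4 z ≡ + 1 / 24 * (x * x * (x * x)) +i 0ℚ
  e₄ = step 3 e₃
    (solve 1 (λ x → con (+ 1 / 4) :* (con 0ℚ :* con 0ℚ :- x :* (con (- (+ 1 / 6)) :* (x :* x :* x)))
      := con (+ 1 / 24) :* (x :* x :* (x :* x))) refl x)
    (solve 1 (λ x → con (+ 1 / 4) :* (con 0ℚ :* (con (- (+ 1 / 6)) :* (x :* x :* x)) :+ x :* con 0ℚ)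
      := con 0ℚ) refl x)
  e₅ : term 5 z ≡ 0ℚ +i + 1 / 120 * (x * x * (x * x) * x)
  e₅ = step 4 e₄
    (solve 1 (λ x → con (+ 1 / 5) :* (con 0ℚ :* (con (+ 1 / 24) :* (x :* x :* (x :* x))) :- x :* con 0ℚ)
      := con 0ℚ) refl x)
    (solve 1 (λ x → con (+ 1 / 5) :* (con 0ℚ :* con 0ℚ :+ x :* (con (+ 1 / 24) :* (x :* x :* (x :* x))))
      := con (+ 1 / 120) :* (x :* x :* (x :* x) :* x)) refl x)

lo hi mid rad : ℚ
lo  = + 7 / 5
hi  = + 7 / 4
mid = + 63 / 40
rad = + 7 / 40

0≤lo : 0ℚ ≤ lo
0≤lo = from-yes (0ℚ ≤? lo)

0≤hi : 0ℚ ≤ hi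
0≤hi = from-yes (0ℚ ≤? hi)

2hi≤4 : hi + hi ≤ natℚ 4
2hi≤4 = from-yes (hi + hi ≤? natℚ 4)

In : ℚ → Set
In x = lo ≤ x × x ≤ hi

In-mid : In mid
In-mid = from-yes (lo ≤? mid) , from-yes (mid ≤? hi)

In-∣∣ : ∀ {x} → In x → ∣ x - mid ∣ ≤ rad
In-∣∣ {x} (l , h) = ∣∣≤ (ℚ.+-monoˡ-≤ (- mid) h) (begin
  - (x - mid)  ≡⟨ solve 1 (λ x → :- (x :- con mid) := con mid :- x) refl x ⟩
  mid - x      ≤⟨ ℚ.+-monoʳ-≤ mid (ℚ.neg-antimono-≤ l) ⟩
  rad          ∎)

∣∣-In : ∀ {x} → ∣ x - mid ∣ ≤ rad → In x
∣∣-In {x} h =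
  (begin
    lo                    ≤⟨ ℚ.+-monoʳ-≤ mid (ℚ.neg-antimono-≤ (ℚ.≤-trans (-≤∣∣ (x - mid)) h)) ⟩
    mid - - (x - mid)     ≡⟨ solve 1 (λ x → con mid :- (:- (x :- con mid)) := x) refl x ⟩
    x                     ∎) ,
  (begin
    x                     ≡⟨ solve 1 (λ x → x := x :- con mid :+ con mid) refl x ⟩
    x - mid + mid         ≤⟨ ℚ.+-monoˡ-≤ mid (ℚ.≤-trans (≤∣∣ (x - mid)) h) ⟩
    hi                    ∎)

In-norm : ∀ {x} → In x → ∥ 0ℚ +i x ∥ ≤ hi
In-norm {x} (l , h) = begin
  0ℚ + ∣ x ∣  ≡⟨ ℚ.+-identityˡ (∣ x ∣) ⟩
  ∣ x ∣       ≡⟨ ℚ.0≤p⇒∣p∣≡p (ℚ.≤-trans 0≤lo l) ⟩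
  x           ≤⟨ h ⟩
  hi          ∎

re-⊕ : ∀ z w → re (z ⊕ w) ≡ re z + re w
re-⊕ (a +i b) (c +i d) = refl

re-⊖ : ∀ z w → re (z ⊖ w) ≡ re z - re w
re-⊖ (a +i b) (c +i d) = refl

∣re∣≤ : ∀ z → ∣ re z ∣ ≤ ∥ z ∥
∣re∣≤ (a +i b) = ≤+ʳ (ℚ.0≤∣p∣ b)

-- the difference quotient of x + cos₅ x
cos₅-lipschitz : ∀ {x y} → In x → In y →
  ∣ (x + cos₅ x) - (y + cos₅ y) ∣ ≤ + 8 / 25 * ∣ x - y ∣
cos₅-lipschitz {x} {y} (lx , hx) (ly , hy) = begin
  ∣ (x + cos₅ x) - (y + cos₅ y) ∣
    ≡⟨ cong ∣_∣ (solve 2 (λ x y →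
         (x :+ (con 1ℚ :- con ½ :* (x :* x) :+ con (+ 1 / 24) :* (x :* x :* (x :* x))))
         :- (y :+ (con 1ℚ :- con ½ :* (y :* y) :+ con (+ 1 / 24) :* (y :* y :* (y :* y))))
         := (con 1ℚ :- con ½ :* (x :+ y) :* (con 1ℚ :- con (+ 1 / 12) :* (x :* x :+ y :* y)))
            :* (x :- y)) refl x y) ⟩
  ∣ (1ℚ - a * b) * (x - y) ∣
    ≡⟨ ℚ.∣p*q∣≡∣p∣*∣q∣ (1ℚ - a * b) (x - y) ⟩
  ∣ 1ℚ - a * b ∣ * ∣ x - y ∣
    ≤⟨ *-monoˡ (ℚ.0≤∣p∣ (x - y)) (∣∣≤ upper lower) ⟩
  + 8 / 25 * ∣ x - y ∣ ∎
  where
  a = ½ * (x + y)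
  u = x * x + y * y
  b = 1ℚ - + 1 / 12 * u
  0≤½ = from-yes (0ℚ ≤? ½)
  0≤1/12 = from-yes (0ℚ ≤? + 1 / 12)
  a-lo : lo ≤ a
  a-lo = *-monoʳ {c = ½} 0≤½ (ℚ.+-mono-≤ lx ly)
  a-hi : a ≤ hi
  a-hi = *-monoʳ {c = ½} 0≤½ (ℚ.+-mono-≤ hx hy)
  0≤x = ℚ.≤-trans 0≤lo lx
  0≤y = ℚ.≤-trans 0≤lo ly
  u-lo : lo * lo + lo * lo ≤ u
  u-lo = ℚ.+-mono-≤ (*-mono 0≤lo 0≤x lx lx) (*-mono 0≤lo 0≤y ly ly)
  u-hi : u ≤ hi * hi + hi * hi
  u-hi = ℚ.+-mono-≤ (*-mono 0≤x 0≤hi hx hx) (*-mono 0≤y 0≤hi hy hy)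
  b-lo : 1ℚ - + 1 / 12 * (hi * hi + hi * hi) ≤ b
  b-lo = ℚ.+-monoʳ-≤ 1ℚ (ℚ.neg-antimono-≤ (*-monoʳ 0≤1/12 u-hi))
  b-hi : b ≤ 1ℚ - + 1 / 12 * (lo * lo + lo * lo)
  b-hi = ℚ.+-monoʳ-≤ 1ℚ (ℚ.neg-antimono-≤ (*-monoʳ 0≤1/12 u-lo))
  0≤a = ℚ.≤-trans 0≤lo a-lo
  0≤b : 0ℚ ≤ b
  0≤b = ℚ.≤-trans (from-yes (0ℚ ≤? 1ℚ - + 1 / 12 * (hi * hi + hi * hi))) b-lo
  upper : 1ℚ - a * b ≤ + 8 / 25
  upper = ℚ.≤-trans
    (ℚ.+-monoʳ-≤ 1ℚ (ℚ.neg-antimono-≤ (*-mono 0≤lo 0≤b a-lo b-lo)))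
    (from-yes (1ℚ - lo * (1ℚ - + 1 / 12 * (hi * hi + hi * hi)) ≤? + 8 / 25))
  lower : - (1ℚ - a * b) ≤ + 8 / 25
  lower = begin
    - (1ℚ - a * b)
      ≡⟨ solve 1 (λ p → :- (con 1ℚ :- p) := p :- con 1ℚ) refl (a * b) ⟩
    a * b - 1ℚ
      ≤⟨ ℚ.+-monoˡ-≤ (- 1ℚ) (*-mono 0≤a (from-yes (0ℚ ≤? 1ℚ - + 1 / 12 * (lo * lo + lo * lo))) a-hi b-hi) ⟩
    hi * (1ℚ - + 1 / 12 * (lo * lo + lo * lo)) - 1ℚ
      ≤⟨ from-yes (hi * (1ℚ - + 1 / 12 * (lo * lo + lo * lo)) - 1ℚ ≤? + 8 / 25) ⟩
    + 8 / 25 ∎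

contraction : ∀ n {x y} → In x → In y →
  ∣ (x + cosₙ (n ℕ.+ 5) x) - (y + cosₙ (n ℕ.+ 5) y) ∣ ≤ + 3 / 5 * ∣ x - y ∣
contraction n {x} {y} hx hy = begin
  ∣ (x + c x) - (y + c y) ∣
    ≡⟨ cong ∣_∣ (trans
         (solve 6 (λ x y cx cy dx dy →
           (x :+ cx) :- (y :+ cy) := ((x :+ dx) :- (y :+ dy)) :+ ((cx :- cy) :- (dx :- dy)))
           refl x y (c x) (c y) (cosₙ 5 x) (cosₙ 5 y))
         (cong₂ (λ a b → (x + a) - (y + b) + r) (cos₅-correct x) (cos₅-correct y))) ⟩
  ∣ ((x + cos₅ x) - (y + cos₅ y)) + r ∣
    ≤⟨ ℚ.∣p+q∣≤∣p∣+∣q∣ ((x + cos₅ x) - (y + cos₅ y)) r ⟩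
  ∣ (x + cos₅ x) - (y + cos₅ y) ∣ + ∣ r ∣
    ≤⟨ ℚ.+-mono-≤ (cos₅-lipschitz hx hy) r-bound ⟩
  + 8 / 25 * ∣ x - y ∣ + + 7 / 25 * ∣ x - y ∣
    ≡⟨ solve 1 (λ d → con (+ 8 / 25) :* d :+ con (+ 7 / 25) :* d := con (+ 3 / 5) :* d)
         refl (∣ x - y ∣) ⟩
  + 3 / 5 * ∣ x - y ∣ ∎
  where
  c = cosₙ (n ℕ.+ 5)
  r = (c x - c y) - (cosₙ 5 x - cosₙ 5 y)
  Px = partial (n ℕ.+ 5) (0ℚ +i x)
  Py = partial (n ℕ.+ 5) (0ℚ +i y)
  Qx = partial 5 (0ℚ +i x)
  Qy = partial 5 (0ℚ +i y)
  w  = Px ⊖ Py ⊖ (Qx ⊖ Qy)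
  r-bound : ∣ r ∣ ≤ + 7 / 25 * ∣ x - y ∣
  r-bound = begin
    ∣ r ∣
      ≡⟨ cong ∣_∣ (trans (re-⊖ (Px ⊖ Py) (Qx ⊖ Qy)) (cong₂ _-_ (re-⊖ Px Py) (re-⊖ Qx Qy))) ⟨
    ∣ re w ∣
      ≤⟨ ∣re∣≤ w ⟩
    ∥ w ∥
      ≤⟨ tail-lipschitz 0≤hi (In-norm hx) (In-norm hy) 5 n ⟩
    (0ℚ + ∣ x - y ∣) * (s hi (n ℕ.+ 5) - s hi 5)
      ≡⟨ cong (_* (s hi (n ℕ.+ 5) - s hi 5)) (ℚ.+-identityˡ (∣ x - y ∣)) ⟩
    ∣ x - y ∣ * (s hi (n ℕ.+ 5) - s hi 5)
      ≤⟨ *-monoʳ (ℚ.0≤∣p∣ (x - y)) (ℚ.≤-trans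
           (s-tail 0≤hi 4 2hi≤4 n (ℕ.m≤m+n 4 1))
           (from-yes (t hi 5 + t hi 5 ≤? + 7 / 25))) ⟩
    ∣ x - y ∣ * (+ 7 / 25)
      ≡⟨ ℚ.*-comm (∣ x - y ∣) (+ 7 / 25) ⟩
    + 7 / 25 * ∣ x - y ∣ ∎

cos-mid : ∀ n → ∣ cosₙ (n ℕ.+ 5) mid ∣ ≤ + 7 / 100
cos-mid n = begin
  ∣ cosₙ (n ℕ.+ 5) mid ∣
    ≡⟨ cong ∣_∣ (solve 2 (λ a b → a := (a :- b) :+ b) refl (cosₙ (n ℕ.+ 5) mid) (cosₙ 5 mid)) ⟩
  ∣ (cosₙ (n ℕ.+ 5) mid - cosₙ 5 mid) + cosₙ 5 mid ∣
    ≤⟨ ℚ.∣p+q∣≤∣p∣+∣q∣ (cosₙ (n ℕ.+ 5) mid - cosₙ 5 mid) (cosₙ 5 mid) ⟩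
  ∣ cosₙ (n ℕ.+ 5) mid - cosₙ 5 mid ∣ + ∣ cosₙ 5 mid ∣
    ≤⟨ ℚ.+-monoˡ-≤ (∣ cosₙ 5 mid ∣) (ℚ.≤-trans
         (ℚ.≤-reflexive (cong ∣_∣ (sym (re-⊖ (partial (n ℕ.+ 5) (0ℚ +i mid)) (partial 5 (0ℚ +i mid))))))
         (ℚ.≤-trans (∣re∣≤ (partial (n ℕ.+ 5) (0ℚ +i mid) ⊖ partial 5 (0ℚ +i mid)))
         (partial-tail 0≤mid 5 n {0ℚ +i mid} (ℚ.≤-reflexive refl)))) ⟩
  s mid (suc n ℕ.+ 5) - s mid 6 + ∣ cosₙ 5 mid ∣
    ≡⟨ cong (λ k → s mid k - s mid 6 + ∣ cosₙ 5 mid ∣) (ℕ.+-suc n 5) ⟨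
  s mid (n ℕ.+ 6) - s mid 6 + ∣ cosₙ 5 mid ∣
    ≤⟨ ℚ.+-monoˡ-≤ (∣ cosₙ 5 mid ∣) (s-tail 0≤mid 4 (from-yes (mid + mid ≤? natℚ 4)) n (ℕ.m≤m+n 4 2)) ⟩
  t mid 6 + t mid 6 + ∣ cosₙ 5 mid ∣
    ≤⟨ from-yes (t mid 6 + t mid 6 + ∣ cosₙ 5 mid ∣ ≤? + 7 / 100) ⟩
  + 7 / 100 ∎
  where
  0≤mid : 0ℚ ≤ mid
  0≤mid = from-yes (0ℚ ≤? mid)

half-π-In : ∀ n → In (half-πₙ n)
half-π-In zero    = from-yes (lo ≤? + 3 / 2) , from-yes (+ 3 / 2 ≤? hi)
half-π-In (suc n) = ∣∣-In (begin
  ∣ x + c x - mid ∣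
    ≡⟨ cong ∣_∣ (solve 3 (λ x cx cm → x :+ cx :- con mid := (x :+ cx :- (con mid :+ cm)) :+ cm)
         refl x (c x) (c mid)) ⟩
  ∣ (x + c x - (mid + c mid)) + c mid ∣
    ≤⟨ ℚ.∣p+q∣≤∣p∣+∣q∣ (x + c x - (mid + c mid)) (c mid) ⟩
  ∣ x + c x - (mid + c mid) ∣ + ∣ c mid ∣
    ≤⟨ ℚ.+-mono-≤ (contraction n (half-π-In n) In-mid) (cos-mid n) ⟩
  + 3 / 5 * ∣ x - mid ∣ + + 7 / 100
    ≤⟨ ℚ.+-monoˡ-≤ (+ 7 / 100) (*-monoʳ (from-yes (0ℚ ≤? + 3 / 5)) (In-∣∣ (half-π-In n))) ⟩
  rad ∎)
  where
  x = half-πₙ n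
  c = cosₙ (n ℕ.+ 5)

half-π-step : ∀ n → ∣ half-πₙ (suc n) - half-πₙ n ∣ ≤ pow n
half-π-step zero    = from-yes (∣ half-πₙ 1 - half-πₙ 0 ∣ ≤? 1ℚ)
half-π-step (suc n) = begin
  ∣ (y + c′ y) - (x + c x) ∣
    ≡⟨ cong ∣_∣ (solve 5 (λ y cy x cx dx → (y :+ cy) :- (x :+ cx) := ((y :+ cy) :- (x :+ dx)) :+ (dx :- cx))
         refl y (c′ y) x (c x) (c′ x)) ⟩
  ∣ ((y + c′ y) - (x + c′ x)) + (c′ x - c x) ∣
    ≤⟨ ℚ.∣p+q∣≤∣p∣+∣q∣ ((y + c′ y) - (x + c′ x)) (c′ x - c x) ⟩
  ∣ (y + c′ y) - (x + c′ x) ∣ + ∣ c′ x - c x ∣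
    ≤⟨ ℚ.+-mono-≤ (contraction (suc n) (half-π-In (suc n)) (half-π-In n)) last-term ⟩
  + 3 / 5 * ∣ y - x ∣ + + 1 / 5 * pow n
    ≤⟨ ℚ.+-monoˡ-≤ (+ 1 / 5 * pow n) (*-monoʳ (from-yes (0ℚ ≤? + 3 / 5)) (half-π-step n)) ⟩
  + 3 / 5 * pow n + + 1 / 5 * pow n
    ≡⟨ solve 1 (λ p → con (+ 3 / 5) :* p :+ con (+ 1 / 5) :* p := con 4/5 :* p) refl (pow n) ⟩
  4/5 * pow n ∎
  where
  x  = half-πₙ n
  y  = half-πₙ (suc n)
  c  = cosₙ (n ℕ.+ 5)
  c′ = cosₙ (suc n ℕ.+ 5)
  T  = term (suc n ℕ.+ 5) (0ℚ +i x)
  last-term : ∣ c′ x - c x ∣ ≤ + 1 / 5 * pow n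
  last-term = begin
    ∣ c′ x - c x ∣
      ≡⟨ cong (λ a → ∣ a - c x ∣) (re-⊕ (partial (n ℕ.+ 5) (0ℚ +i x)) T) ⟩
    ∣ c x + re T - c x ∣
      ≡⟨ cong ∣_∣ (solve 2 (λ a b → a :+ b :- a := b) refl (c x) (re T)) ⟩
    ∣ re T ∣
      ≤⟨ ∣re∣≤ T ⟩
    ∥ T ∥
      ≤⟨ term-bound 0≤hi (suc n ℕ.+ 5) (In-norm (half-π-In n)) ⟩
    t hi (suc n ℕ.+ 5)
      ≡⟨ cong (t hi) (ℕ.+-suc n 5) ⟨
    t hi (n ℕ.+ 6)
      ≤⟨ t-decay 0≤hi 4 2hi≤4 n (ℕ.m≤m+n 4 2) ⟩
    t hi 6 * pow n
      ≤⟨ *-monoˡ (0≤pow n) (from-yes (t hi 6 ≤? + 1 / 5)) ⟩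
    + 1 / 5 * pow n ∎

half-π-tail : ∀ n j → ∣ half-πₙ (j ℕ.+ n) - half-πₙ n ∣ ≤ natℚ 5 * (pow n - pow (j ℕ.+ n))
half-π-tail n zero = ℚ.≤-reflexive (trans
  (cong ∣_∣ (ℚ.+-inverseʳ (half-πₙ n)))
  (solve 1 (λ p → con 0ℚ := con (natℚ 5) :* (p :- p)) refl (pow n)))
half-π-tail n (suc j) = begin
  ∣ h (suc k) - h n ∣
    ≡⟨ cong ∣_∣ (solve 3 (λ a b c → a :- c := (a :- b) :+ (b :- c)) refl (h (suc k)) (h k) (h n)) ⟩
  ∣ (h (suc k) - h k) + (h k - h n) ∣
    ≤⟨ ℚ.∣p+q∣≤∣p∣+∣q∣ (h (suc k) - h k) (h k - h n) ⟩
  ∣ h (suc k) - h k ∣ + ∣ h k - h n ∣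
    ≤⟨ ℚ.+-mono-≤ (half-π-step k) (half-π-tail n j) ⟩
  pow k + natℚ 5 * (pow n - pow k)
    ≡⟨ solve 2 (λ p q → p :+ con (natℚ 5) :* (q :- p) := con (natℚ 5) :* (q :- con 4/5 :* p))
         refl (pow k) (pow n) ⟩
  natℚ 5 * (pow n - 4/5 * pow k) ∎
  where
  k = j ℕ.+ n
  h = half-πₙ

half-π : ℂ
half-π .seq n = half-πₙ n +i 0ℚ
half-π .cauchy ε 0<ε = choose-N (pow-small (natℚ 5) ε (0≤natℚ 5) 0<ε)
  where
  h = half-πₙ
  ordered : ∀ {N} → (∀ n → N ℕ.≤ n → natℚ 5 * pow n < ε) →
    ∀ j n → N ℕ.≤ n → ∥ (h (j ℕ.+ n) +i 0ℚ) ⊖ (h n +i 0ℚ) ∥ < ε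
  ordered hN j n N≤n = begin-strict
    ∣ h (j ℕ.+ n) - h n ∣ + 0ℚ              ≡⟨ ℚ.+-identityʳ (∣ h (j ℕ.+ n) - h n ∣) ⟩
    ∣ h (j ℕ.+ n) - h n ∣                   ≤⟨ half-π-tail n j ⟩
    natℚ 5 * (pow n - pow (j ℕ.+ n))
      ≤⟨ *-monoʳ (0≤natℚ 5) (ℚ.+-monoʳ-≤ (pow n) (ℚ.neg-antimono-≤ (0≤pow (j ℕ.+ n)))) ⟩
    natℚ 5 * (pow n - 0ℚ)                   ≡⟨ cong (natℚ 5 *_) (ℚ.+-identityʳ (pow n)) ⟩
    natℚ 5 * pow n                          <⟨ hN n N≤n ⟩
    ε                                       ∎
  choose-N : (∃ λ N → ∀ n → N ℕ.≤ n → natℚ 5 * pow n < ε) →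
    ∃ λ N → ∀ m n → N ℕ.≤ m → N ℕ.≤ n → ∥ (h m +i 0ℚ) ⊖ (h n +i 0ℚ) ∥ < ε
  choose-N (N , hN) = N , from-ordered (λ n → h n +i 0ℚ) (ordered hN)

π : ℂ
π = fromℚ (natℚ 2) *ᶜ half-π

∑ ∏ : ∀ {A : Set} → List A → (A → ℂ) → ℂ
∑ xs f = foldr (λ x → f x +ᶜ_) 0ᶜ xs
∏ xs f = foldr (λ x → f x *ᶜ_) 1ᶜ xs

[1⋯_] : ℕ → List ℕ
[1⋯ n ] = applyUpTo suc n

-- Divisors are enumerated as suc e, so that one can divide by them.
∑∣ : (n : ℕ) → ((d : ℕ) .{{_ : NonZero d}} → ℂ) → ℂ
∑∣ n f = ∑ (filter (λ e → suc e ∣? n) (upTo n)) (λ e → f (suc e))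

totatives : ℕ → List ℕ
totatives n = filter (λ j → gcd j n ℕ.≟ 1) [1⋯ n ]

φ : ℕ → ℕ
φ n = length (totatives n)

2πi : ℂ
2πi = fromℚ (natℚ 2) *ᶜ π *ᶜ i

c : (n : ℕ) .{{_ : NonZero n}} → ℕ → ℂ
c n k = ∑ (totatives n) λ j → exp (2πi *ᶜ fromℚ (+ (j ℕ.* k) / n))

lcms : ∀ {r} → (Fin r → ℕ) → ℕ
lcms {zero}  m = 1
lcms {suc r} m = lcm (m zero) (lcms (m ∘ suc))

lcms-nonZero : ∀ {r} (m : Fin r → ℕ) → (∀ a → NonZero (m a)) → NonZero (lcms m)
lcms-nonZero {zero}  m pos = _
lcms-nonZero {suc r} m pos = ℕ.≢-nonZero λ lcm≡0 →
  ℕ.≢-nonZero⁻¹ (m zero ℕ.* l) {{ℕ.m*n≢0 (m zero) l {{pos zero}} {{l≢0}}}}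
    (trans (sym (gcd*lcm (m zero) l))
           (trans (cong (gcd (m zero) l ℕ.*_) lcm≡0) (ℕ.*-zeroʳ (gcd (m zero) l))))
  where
  l   = lcms (m ∘ suc)
  l≢0 = lcms-nonZero (m ∘ suc) (pos ∘ suc)

1/lcms : ∀ {r} (m : Fin r → ℕ) → (∀ a → NonZero (m a)) → ℂ
1/lcms m pos = fromℚ ((+ 1 / lcms m) {{lcms-nonZero m pos}})

∏c : ∀ {r} (m : Fin r → ℕ) → (∀ a → NonZero (m a)) → ℕ → ℂ
∏c {r} m pos k = ∏ (allFin r) λ a → c (m a) {{pos a}} k

-- The mean over M consecutive values is the same for every positive multiple M
-- of lcms m; here M = lcms m.
E : ∀ {r} (m : Fin r → ℕ) → (∀ a → NonZero (m a)) → ℂ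
E m pos = 1/lcms m pos *ᶜ ∑ [1⋯ lcms m ] (∏c m pos)

{-# OPTIONS --safe #-}

-- For n ∣ l the Ramanujan sum c n k depends on k only through d = gcd k l.  Indeed
-- k = d u with u coprime to l / d, and u lifts to a unit modulo l; multiplication
-- by a unit permutes the totatives of n, and exp (2πi j k / n) depends only on
-- j k modulo n.  So the product of the sums is constant on each class
-- {k ≤ l ∣ gcd k l = d}, which has φ (l / d) elements.
--
-- The periodicity of exp (2πi x) rests on two facts about the series.
-- The product formula: the part of the Cauchy product of degree above n is at
-- most a constant times pow n.  And exp (2πi) = 1: for e = exp (iπ/2) the iteration
-- defining π/2 gives re e = 0, so exp (- iπ/2), the conjugate of e, is - e;
-- hence e² = - e exp (- iπ/2) = - 1.

module Submission where

open import Algebra.Bundles using (CommutativeRing)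
open import Algebra.Solver.Ring.AlmostCommutativeRing using (fromCommutativeRing)
import Algebra.Solver.Ring.Simple as RingSolver
open import Data.Empty using (⊥-elim)
open import Data.Fin using (Fin)
import Data.Fin as Fin
import Data.Integer as ℤ
import Data.Integer.Properties as ℤ
open import Data.List using (List; []; _∷_; _++_; map; concatMap; filter; length; upTo; allFin)
open import Data.List.Membership.Propositional using (_∈_)
open import Data.List.Membership.Propositional.Properties
  using (∈-map⁺; ∈-map⁻; ∈-filter⁺; ∈-filter⁻; ∈-applyUpTo⁺; ∈-applyUpTo⁻; ∈-upTo⁺;
         ∈-concat⁺′; ∈-concat⁻′)
open import Data.List.Membership.Propositional.Properties.WithK using (unique∧set⇒bag)
open import Data.List.Relation.Binary.BagAndSetEquality using (∼bag⇒↭)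
open import Data.List.Relation.Binary.Disjoint.Propositional using (Disjoint)
open import Data.List.Relation.Binary.Permutation.Propositional as ↭ using (_↭_; prep; swap)
import Data.List.Relation.Unary.All as All
import Data.List.Relation.Unary.All.Properties as All
open import Data.List.Relation.Unary.AllPairs as AllPairs using ([]; _∷_)
import Data.List.Relation.Unary.AllPairs.Properties as AllPairs
open import Data.List.Relation.Unary.Any using (here; there)
open import Data.List.Relation.Unary.Unique.Propositional using (Unique)
import Data.List.Relation.Unary.Unique.Propositional.Properties as Unique
open import Data.Nat using (ℕ; NonZero; _/_)
open import Data.Nat as ℕ using (zero; suc; z≤n; s≤s)
open import Data.Nat.Coprimality
  using (Coprime; coprime⇒gcd≡1; gcd≡1⇒coprime; coprime-divisor; coprime-Bézout)
open import Data.Nat.Divisibility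
  using (_∣_; _∣?_; divides; ∣-refl; ∣-trans; ∣⇒≤; ∣1⇒≡1; ∣m∣n⇒∣m+n; ∣m+n∣m⇒∣n; ∣m⇒∣m*n; ∣n⇒∣m*n)
open import Data.Nat.DivMod
  using (/-congˡ; m≡m%n+[m/n]*n; m%n<n; [m+kn]%n≡m%n; m<n⇒m%n≡m; m*n/n≡m; m/n*n≡m; m*[n/m]≡n)
open import Data.Nat.GCD
  using (gcd; gcd[m,n]∣m; gcd[m,n]∣n; gcd[m,n]≡0⇒m≡0; gcd[m,n]≡0⇒n≡0; c*gcd[m,n]≡gcd[cm,cn];
         module Bézout)
open import Data.Nat.Induction using (<-rec)
open import Data.Nat.LCM using (m∣lcm[m,n]; n∣lcm[m,n])
import Data.Nat.Properties as ℕ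
open import Data.Product using (∃; _×_; _,_; proj₁; proj₂)
open import Data.Rational as ℚ using (ℚ; 0ℚ; 1ℚ; ½)
import Data.Rational.Properties as ℚ
open import Data.Rational.Unnormalised using (*≡*)
import Data.Rational.Unnormalised.Properties as ℚᵘ
open import Function using (_∘_; mk⇔)
open import Level using (0ℓ)
open import Relation.Binary.Bundles using (Setoid)
open import Relation.Binary.Definitions using (DecidableEquality)
open import Relation.Binary.PropositionalEquality
import Relation.Binary.Reasoning.Setoid as SetoidReasoning
open import Relation.Nullary.Decidable using (from-yes; yes; no)
open import Defs

-- The exponential function

module _ where
  open import Data.Integer using (+_)
  open import Data.Rational using (_+_; _*_; _-_; -_; ∣_∣; _≤_; _<_; _≤?_)
  open import Data.Rational.Solver using (module +-*-Solver)
  open +-*-Solver using (solve; _:+_; _:*_; _:-_; :-_; _:=_; con)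

  -- The ring of Gaussian rationals

  neg : ℚ[i] → ℚ[i]
  neg (a +i b) = (- a) +i (- b)

  ⊖-neg : ∀ z w → z ⊖ w ≡ z ⊕ neg w
  ⊖-neg (a +i b) (c +i d) = refl

  ⊗-assoc : ∀ x y z → (x ⊗ y) ⊗ z ≡ x ⊗ (y ⊗ z)
  ⊗-assoc (a +i b) (c +i d) (e +i f) = cong₂ _+i_
    (solve 6 (λ a b c d e f → (a :* c :- b :* d) :* e :- (a :* d :+ b :* c) :* f
       := a :* (c :* e :- d :* f) :- b :* (c :* f :+ d :* e)) refl a b c d e f)
    (solve 6 (λ a b c d e f → (a :* c :- b :* d) :* f :+ (a :* d :+ b :* c) :* e
       := a :* (c :* f :+ d :* e) :+ b :* (c :* e :- d :* f)) refl a b c d e f)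

  ⊗-comm : ∀ x y → x ⊗ y ≡ y ⊗ x
  ⊗-comm (a +i b) (c +i d) = cong₂ _+i_
    (solve 4 (λ a b c d → a :* c :- b :* d := c :* a :- d :* b) refl a b c d)
    (solve 4 (λ a b c d → a :* d :+ b :* c := c :* b :+ d :* a) refl a b c d)

  ⊗-identityˡ : ∀ x → 1ᵍ ⊗ x ≡ x
  ⊗-identityˡ (a +i b) = cong₂ _+i_
    (solve 2 (λ a b → con 1ℚ :* a :- con 0ℚ :* b := a) refl a b)
    (solve 2 (λ a b → con 1ℚ :* b :+ con 0ℚ :* a := b) refl a b)

  ⊗-distribˡ : ∀ x y z → x ⊗ (y ⊕ z) ≡ x ⊗ y ⊕ x ⊗ z
  ⊗-distribˡ (a +i b) (c +i d) (e +i f) = cong₂ _+i_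
    (solve 6 (λ a b c d e f → a :* (c :+ e) :- b :* (d :+ f)
       := (a :* c :- b :* d) :+ (a :* e :- b :* f)) refl a b c d e f)
    (solve 6 (λ a b c d e f → a :* (d :+ f) :+ b :* (c :+ e)
       := (a :* d :+ b :* c) :+ (a :* f :+ b :* e)) refl a b c d e f)

  ⊕-assoc : ∀ x y z → (x ⊕ y) ⊕ z ≡ x ⊕ (y ⊕ z)
  ⊕-assoc (a +i b) (c +i d) (e +i f) = cong₂ _+i_ (ℚ.+-assoc a c e) (ℚ.+-assoc b d f)

  ⊕-comm : ∀ x y → x ⊕ y ≡ y ⊕ x
  ⊕-comm (a +i b) (c +i d) = cong₂ _+i_ (ℚ.+-comm a c) (ℚ.+-comm b d)

  ⊕-identityˡ : ∀ x → 0ᵍ ⊕ x ≡ x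
  ⊕-identityˡ (a +i b) = cong₂ _+i_ (ℚ.+-identityˡ a) (ℚ.+-identityˡ b)

  ⊕-inverseˡ : ∀ x → neg x ⊕ x ≡ 0ᵍ
  ⊕-inverseˡ (a +i b) = cong₂ _+i_ (ℚ.+-inverseˡ a) (ℚ.+-inverseˡ b)

  -- Packaged so that a ring solver can treat Gaussian rationals as single variables instead of
  -- pairs of rationals.
  ℚ[i]-commutativeRing : CommutativeRing 0ℓ 0ℓ
  ℚ[i]-commutativeRing = record
    { Carrier = ℚ[i] ; _≈_ = _≡_ ; _+_ = _⊕_ ; _*_ = _⊗_ ; -_ = neg ; 0# = 0ᵍ ; 1# = 1ᵍ
    ; isCommutativeRing = record
      { isRing = record
        { +-isAbelianGroup = record
          { isGroup = record
            { isMonoid = record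
              { isSemigroup = record
                { isMagma = record { isEquivalence = isEquivalence ; ∙-cong = cong₂ _⊕_ }
                ; assoc = ⊕-assoc }
              ; identity = ⊕-identityˡ , λ x → trans (⊕-comm x 0ᵍ) (⊕-identityˡ x) }
            ; inverse = ⊕-inverseˡ , λ x → trans (⊕-comm x (neg x)) (⊕-inverseˡ x)
            ; ⁻¹-cong = cong neg }
          ; comm = ⊕-comm }
        ; *-cong = cong₂ _⊗_
        ; *-assoc = ⊗-assoc
        ; *-identity = ⊗-identityˡ , λ x → trans (⊗-comm x 1ᵍ) (⊗-identityˡ x)
        ; distrib = ⊗-distribˡ , λ x y z → trans (⊗-comm (y ⊕ z) x)
            (trans (⊗-distribˡ x y z) (cong₂ _⊕_ (⊗-comm x y) (⊗-comm x z))) }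
      ; *-comm = ⊗-comm } }

  _≟ᵍ_ : DecidableEquality ℚ[i]
  (a +i b) ≟ᵍ (c +i d) with a ℚ.≟ c | b ℚ.≟ d
  ... | yes refl | yes refl = yes refl
  ... | no  a≢c  | _        = no λ { refl → a≢c refl }
  ... | _        | no b≢d   = no λ { refl → b≢d refl }

  open RingSolver (fromCommutativeRing ℚ[i]-commutativeRing) _≟ᵍ_
    using () renaming (solve to solveᵍ; _:+_ to _⊞_; _:*_ to _⊠_; :-_ to ⊟_; _:=_ to _⊜_; con to conᵍ)

  -- Scaling is rewritten as a product because the solver works with the ring operations only.
  •-⊗ : ∀ r z → r • z ≡ (r +i 0ℚ) ⊗ z
  •-⊗ r (a +i b) = cong₂ _+i_
    (solve 3 (λ r a b → r :* a := r :* a :- con 0ℚ :* b) refl r a b)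
    (solve 3 (λ r a b → r :* b := r :* b :+ con 0ℚ :* a) refl r a b)

  -- Null sequences and equality of complex numbers

  -- `x ≈ y` unfolds to `Null` of the distances of the approximations, so that equalities of complex
  -- numbers follow by comparing and adding null sequences.
  Null : (ℕ → ℚ) → Set
  Null u = ∀ ε → 0ℚ < ε → ∃ λ N → ∀ n → N ℕ.≤ n → u n < ε

  null-≤ : ∀ {u v} → (∀ n → v n ≤ u n) → Null u → Null v
  null-≤ v≤u hu ε 0<ε =
    proj₁ (hu ε 0<ε) , λ n N≤n → ℚ.≤-<-trans (v≤u n) (proj₂ (hu ε 0<ε) n N≤n)

  null-0 : Null (λ _ → 0ℚ)
  null-0 ε 0<ε = 0 , λ _ _ → 0<ε

  null-pow : ∀ {K} → 0ℚ ≤ K → Null (λ n → K * pow n)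
  null-pow {K} 0≤K ε = pow-small K ε 0≤K

  null-* : ∀ {K u} → 0ℚ ≤ K → Null u → Null (λ n → K * u n)
  null-* {K} {u} 0≤K hu ε 0<ε = choose-δ (shrink K ε 0≤K 0<ε)
    where
    choose-δ : (∃ λ δ → 0ℚ < δ × K * δ < ε) → ∃ λ N → ∀ n → N ℕ.≤ n → K * u n < ε
    choose-δ (δ , 0<δ , Kδ<ε) = proj₁ (hu δ 0<δ) , λ n N≤n →
      ℚ.≤-<-trans (*-monoʳ 0≤K (ℚ.<⇒≤ (proj₂ (hu δ 0<δ) n N≤n))) Kδ<ε

  null-+ : ∀ {u v} → Null u → Null v → Null (λ n → u n + v n)
  null-+ {u} {v} hu hv ε 0<ε = M ℕ.⊔ N , λ n M⊔N≤n →
      subst (u n + v n <_) (solve 1 (λ e → con ½ :* e :+ con ½ :* e := e) refl ε)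
        (ℚ.+-mono-< (proj₂ (hu (½ * ε) 0<ε/2) n (ℕ.m⊔n≤o⇒m≤o M N M⊔N≤n))
                    (proj₂ (hv (½ * ε) 0<ε/2) n (ℕ.m⊔n≤o⇒n≤o M N M⊔N≤n)))
    where
    0<ε/2 : 0ℚ < ½ * ε
    0<ε/2 = ℚ.*-monoʳ-<-pos ½ 0<ε
    M = proj₁ (hu (½ * ε) 0<ε/2)
    N = proj₁ (hv (½ * ε) 0<ε/2)

  null-unshift : ∀ k {u} → Null (λ n → u (n ℕ.+ k)) → Null u
  null-unshift k {u} hu ε 0<ε = N ℕ.+ k , λ n N+k≤n →
    subst (λ m → u m < ε) (ℕ.m∸n+n≡m (ℕ.≤-trans (ℕ.m≤n+m k N) N+k≤n))
      (proj₂ (hu ε 0<ε) (n ℕ.∸ k) (ℕ.m+n≤o⇒m≤o∸n N N+k≤n))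
    where N = proj₁ (hu ε 0<ε)

  pointwise : ∀ {x y} → (∀ n → seq x n ≡ seq y n) → x ≈ y
  pointwise {x} {y} h = null-≤ (λ n → ℚ.≤-reflexive
    (trans (cong (λ z → ∥ z ⊖ seq y n ∥) (h n)) (∥⊖∥-self (seq y n)))) null-0

  ≈-refl : ∀ {x} → x ≈ x
  ≈-refl {x} = pointwise {x} {x} (λ _ → refl)

  ≈-sym : ∀ {x y} → x ≈ y → y ≈ x
  ≈-sym {x} {y} = null-≤ (λ n → ℚ.≤-reflexive (∥⊖∥-sym (seq y n) (seq x n)))

  ≈-trans : ∀ {x y z} → x ≈ y → y ≈ z → x ≈ z
  ≈-trans {x} {y} {z} p q =
    null-≤ (λ n → ∥⊖∥-triangle (seq x n) (seq y n) (seq z n)) (null-+ p q)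

  ℂ-setoid : Setoid 0ℓ 0ℓ
  ℂ-setoid = record
    { Carrier = ℂ ; _≈_ = _≈_
    ; isEquivalence = record
      { refl  = λ {x} → ≈-refl {x}
      ; sym   = λ {x y} → ≈-sym {x} {y}
      ; trans = λ {x y z} → ≈-trans {x} {y} {z} } }

  module ≈-Reasoning = SetoidReasoning ℂ-setoid

  +ᶜ-cong : ∀ {x y z w} → x ≈ y → z ≈ w → x +ᶜ z ≈ y +ᶜ w
  +ᶜ-cong {x} {y} {z} {w} p q = null-≤ (λ n → ℚ.≤-trans
      (ℚ.≤-reflexive (cong ∥_∥ (⊕-⊖-⊕ (seq x n) (seq z n) (seq y n) (seq w n))))
      (∥⊕∥ (seq x n ⊖ seq y n) (seq z n ⊖ seq w n)))
    (null-+ p q)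

  Bounded : ℂ → Set
  Bounded x = ∃ λ B → 0ℚ ≤ B × (∀ n → ∥ seq x n ∥ ≤ B)

  -- The difference of the products is `x ⊗ (z ⊖ w) ⊕ (x ⊖ y) ⊗ w`, so bounds for `x` and `w`
  -- suffice.
  *ᶜ-cong : ∀ {x y z w} → x ≈ y → z ≈ w → x *ᶜ z ≈ y *ᶜ w
  *ᶜ-cong {x} {y} {z} {w} p q = choose-bounds (bounded x) (bounded w)
    where
    choose-bounds : Bounded x → Bounded w → x *ᶜ z ≈ y *ᶜ w
    choose-bounds (A , 0≤A , hA) (B , 0≤B , hB) = null-≤ (λ n → ℚ.≤-trans
        (∥⊗⊖⊗∥ (seq x n) (seq z n) (seq y n) (seq w n))
        (ℚ.+-mono-≤ (*-monoˡ (0≤∥∥ (seq z n ⊖ seq w n)) (hA n))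
          (ℚ.≤-trans (*-monoʳ (0≤∥∥ (seq x n ⊖ seq y n)) (hB n))
            (ℚ.≤-reflexive (ℚ.*-comm (∥ seq x n ⊖ seq y n ∥) B)))))
      (null-+ (null-* 0≤A q) (null-* 0≤B p))

  -- Cauchy products of coefficient sequences

  shift : (ℕ → ℚ[i]) → ℕ → ℚ[i]
  shift f k = f (suc k)

  -- The coefficient sequence of the derivative of a power series.
  D : (ℕ → ℚ[i]) → ℕ → ℚ[i]
  D f k = (natℚ (suc k) +i 0ℚ) ⊗ f (suc k)

  -- The coefficients of the Cauchy product. Peeling off the first coefficient of `f` keeps
  -- subtraction out of the indices.
  conv : (ℕ → ℚ[i]) → (ℕ → ℚ[i]) → ℕ → ℚ[i]
  conv f g zero    = f 0 ⊗ g 0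
  conv f g (suc n) = f 0 ⊗ g (suc n) ⊕ conv (shift f) g n

  conv-cong : ∀ {f f′ g g′} → (∀ k → f k ≡ f′ k) → (∀ k → g k ≡ g′ k) →
    ∀ n → conv f g n ≡ conv f′ g′ n
  conv-cong p q zero    = cong₂ _⊗_ (p 0) (q 0)
  conv-cong p q (suc n) =
    cong₂ _⊕_ (cong₂ _⊗_ (p 0) (q (suc n))) (conv-cong (p ∘ suc) q n)

  conv-⊕ˡ : ∀ f f′ g n → conv (λ k → f k ⊕ f′ k) g n ≡ conv f g n ⊕ conv f′ g n
  conv-⊕ˡ f f′ g zero    = solveᵍ 3 (λ a b c → (a ⊞ b) ⊠ c ⊜ a ⊠ c ⊞ b ⊠ c) refl (f 0) (f′ 0) (g 0)
  conv-⊕ˡ f f′ g (suc n) = trans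
    (cong ((f 0 ⊕ f′ 0) ⊗ g (suc n) ⊕_) (conv-⊕ˡ (shift f) (shift f′) g n))
    (solveᵍ 5 (λ a b c u v → (a ⊞ b) ⊠ c ⊞ (u ⊞ v) ⊜ (a ⊠ c ⊞ u) ⊞ (b ⊠ c ⊞ v)) refl
      (f 0) (f′ 0) (g (suc n)) (conv (shift f) g n) (conv (shift f′) g n))

  conv-⊗ˡ : ∀ z f g n → conv (λ k → z ⊗ f k) g n ≡ z ⊗ conv f g n
  conv-⊗ˡ z f g zero    = ⊗-assoc z (f 0) (g 0)
  conv-⊗ˡ z f g (suc n) = trans
    (cong (z ⊗ f 0 ⊗ g (suc n) ⊕_) (conv-⊗ˡ z (shift f) g n))
    (solveᵍ 4 (λ z a b u → z ⊠ a ⊠ b ⊞ z ⊠ u ⊜ z ⊠ (a ⊠ b ⊞ u)) refl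
      z (f 0) (g (suc n)) (conv (shift f) g n))

  conv-⊗ʳ : ∀ z f g n → conv f (λ k → z ⊗ g k) n ≡ z ⊗ conv f g n
  conv-⊗ʳ z f g zero    = solveᵍ 3 (λ z a b → a ⊠ (z ⊠ b) ⊜ z ⊠ (a ⊠ b)) refl z (f 0) (g 0)
  conv-⊗ʳ z f g (suc n) = trans
    (cong (f 0 ⊗ (z ⊗ g (suc n)) ⊕_) (conv-⊗ʳ z (shift f) g n))
    (solveᵍ 4 (λ z a b u → a ⊠ (z ⊠ b) ⊞ z ⊠ u ⊜ z ⊠ (a ⊠ b ⊞ u)) refl
      z (f 0) (g (suc n)) (conv (shift f) g n))

  natᵍ-suc : ∀ n → natℚ (suc n) +i 0ℚ ≡ (natℚ n +i 0ℚ) ⊕ 1ᵍ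
  natᵍ-suc n = cong₂ _+i_ (natℚ-suc n) refl

  -- The product rule for formal power series. In the induction `n + 2` splits as `(n + 1) + 1`: the
  -- multiple by `n + 1` is the statement for `shift f`, and the remaining copy supplies the leading
  -- coefficient of `D f` and corrects `D (shift f)` to `shift (D f)`.
  leibniz : ∀ f g n → D (conv f g) n ≡ conv (D f) g n ⊕ conv f (D g) n
  leibniz f g zero = solveᵍ 4 (λ a b c d →
    conᵍ 1ᵍ ⊠ (a ⊠ d ⊞ b ⊠ c) ⊜ (conᵍ 1ᵍ ⊠ b) ⊠ c ⊞ a ⊠ (conᵍ 1ᵍ ⊠ d)) refl
    (f 0) (f 1) (g 0) (g 1)
  leibniz f g (suc n) = begin
    N₂ ⊗ (f 0 ⊗ g₂ ⊕ (f 1 ⊗ g₁ ⊕ V))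
      ≡⟨ cong (_⊗ (f 0 ⊗ g₂ ⊕ (f 1 ⊗ g₁ ⊕ V))) (natᵍ-suc (suc n)) ⟩
    (N₁ ⊕ 1ᵍ) ⊗ (f 0 ⊗ g₂ ⊕ (f 1 ⊗ g₁ ⊕ V))
      ≡⟨ solveᵍ 4 (λ N a b V → (N ⊞ conᵍ 1ᵍ) ⊠ (a ⊞ (b ⊞ V))
                     ⊜ (N ⊞ conᵍ 1ᵍ) ⊠ a ⊞ (N ⊠ (b ⊞ V) ⊞ (b ⊞ V))) refl
           N₁ (f 0 ⊗ g₂) (f 1 ⊗ g₁) V ⟩
    (N₁ ⊕ 1ᵍ) ⊗ (f 0 ⊗ g₂) ⊕ (N₁ ⊗ (f 1 ⊗ g₁ ⊕ V) ⊕ (f 1 ⊗ g₁ ⊕ V))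
      ≡⟨ cong₂ (λ N u → N ⊗ (f 0 ⊗ g₂) ⊕ (u ⊕ (f 1 ⊗ g₁ ⊕ V)))
           (sym (natᵍ-suc (suc n))) (leibniz (shift f) g n) ⟩
    N₂ ⊗ (f 0 ⊗ g₂) ⊕ ((X ⊕ Y) ⊕ (f 1 ⊗ g₁ ⊕ V))
      ≡⟨ solveᵍ 8 (λ N a g₂ X Y b g₁ V →
           N ⊠ (a ⊠ g₂) ⊞ ((X ⊞ Y) ⊞ (b ⊠ g₁ ⊞ V))
           ⊜ ((conᵍ 1ᵍ ⊠ b) ⊠ g₁ ⊞ (X ⊞ V)) ⊞ (a ⊠ (N ⊠ g₂) ⊞ Y)) refl
           N₂ (f 0) g₂ X Y (f 1) g₁ V ⟩
    ((1ᵍ ⊗ f 1) ⊗ g₁ ⊕ (X ⊕ V)) ⊕ (f 0 ⊗ (N₂ ⊗ g₂) ⊕ Y)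
      ≡⟨ cong (λ u → ((1ᵍ ⊗ f 1) ⊗ g₁ ⊕ u) ⊕ (f 0 ⊗ (N₂ ⊗ g₂) ⊕ Y))
           (sym (trans (conv-cong shift-D (λ _ → refl) n)
                    (conv-⊕ˡ (D (shift f)) (shift (shift f)) g n))) ⟩
    conv (D f) g (suc n) ⊕ conv f (D g) (suc n) ∎
    where
    open ≡-Reasoning
    N₂ = natℚ (suc (suc n)) +i 0ℚ
    N₁ = natℚ (suc n) +i 0ℚ
    g₂ = g (suc (suc n))
    g₁ = g (suc n)
    V  = conv (shift (shift f)) g n
    X  = conv (D (shift f)) g n
    Y  = conv (shift f) (D g) n
    shift-D : ∀ k → shift (D f) k ≡ D (shift f) k ⊕ shift (shift f) k
    shift-D k = trans (cong (_⊗ f (suc (suc k))) (natᵍ-suc (suc k)))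
      (solveᵍ 2 (λ N a → (N ⊞ conᵍ 1ᵍ) ⊠ a ⊜ N ⊠ a ⊞ a) refl (natℚ (suc k) +i 0ℚ) (f (suc (suc k))))

  terms : ℚ[i] → ℕ → ℚ[i]
  terms z k = term k z

  recip-cancel : ∀ k z → (recip k +i 0ℚ) ⊗ ((natℚ (suc k) +i 0ℚ) ⊗ z) ≡ z
  recip-cancel k (a +i b) = cong₂ _+i_
    (trans (solve 4 (λ r n a b → r :* (n :* a :- con 0ℚ :* b) :- con 0ℚ :* (n :* b :+ con 0ℚ :* a)
                      := (r :* n) :* a) refl r n a b)
           (trans (cong (_* a) (recip-inverse k)) (ℚ.*-identityˡ a)))
    (trans (solve 4 (λ r n a b → r :* (n :* b :+ con 0ℚ :* a) :+ con 0ℚ :* (n :* a :- con 0ℚ :* b)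
                      := (r :* n) :* b) refl r n a b)
           (trans (cong (_* b) (recip-inverse k)) (ℚ.*-identityˡ b)))
    where
    r = recip k
    n = natℚ (suc k)

  -- `terms z` are the coefficients of the series exp (zX) in X, whose derivative is z times the
  -- series.
  D-terms : ∀ z k → D (terms z) k ≡ z ⊗ term k z
  D-terms z k = begin
    N ⊗ (recip k • (z ⊗ term k z))             ≡⟨ cong (N ⊗_) (•-⊗ (recip k) (z ⊗ term k z)) ⟩
    N ⊗ ((recip k +i 0ℚ) ⊗ (z ⊗ term k z))
      ≡⟨ solveᵍ 3 (λ N r u → N ⊠ (r ⊠ u) ⊜ r ⊠ (N ⊠ u)) refl N (recip k +i 0ℚ) (z ⊗ term k z) ⟩
    (recip k +i 0ℚ) ⊗ (N ⊗ (z ⊗ term k z))     ≡⟨ recip-cancel k (z ⊗ term k z) ⟩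
    z ⊗ term k z                               ∎
    where
    open ≡-Reasoning
    N = natℚ (suc k) +i 0ℚ

  -- Both sides solve the recurrence D u = (z ⊕ w) ⊗ u with u 0 = 1.
  term-⊕ : ∀ z w n → term n (z ⊕ w) ≡ conv (terms z) (terms w) n
  term-⊕ z w zero    = refl
  term-⊕ z w (suc n) = begin
    recip n • ((z ⊕ w) ⊗ term n (z ⊕ w))
      ≡⟨ •-⊗ (recip n) ((z ⊕ w) ⊗ term n (z ⊕ w)) ⟩
    R ⊗ ((z ⊕ w) ⊗ term n (z ⊕ w))
      ≡⟨ cong (λ u → R ⊗ ((z ⊕ w) ⊗ u)) (term-⊕ z w n) ⟩
    R ⊗ ((z ⊕ w) ⊗ C)
      ≡⟨ cong (R ⊗_) (solveᵍ 3 (λ z w c → (z ⊞ w) ⊠ c ⊜ z ⊠ c ⊞ w ⊠ c) refl z w C) ⟩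
    R ⊗ (z ⊗ C ⊕ w ⊗ C)
      ≡⟨ cong (R ⊗_) (cong₂ _⊕_
           (trans (conv-cong (D-terms z) (λ _ → refl) n) (conv-⊗ˡ z (terms z) (terms w) n))
           (trans (conv-cong (λ _ → refl) (D-terms w) n) (conv-⊗ʳ w (terms z) (terms w) n))) ⟨
    R ⊗ (conv (D (terms z)) (terms w) n ⊕ conv (terms z) (D (terms w)) n)
      ≡⟨ cong (R ⊗_) (leibniz (terms z) (terms w) n) ⟨
    R ⊗ D (conv (terms z) (terms w)) n
      ≡⟨ recip-cancel n (conv (terms z) (terms w) (suc n)) ⟩
    conv (terms z) (terms w) (suc n) ∎
    where
    open ≡-Reasoning
    R = recip n +i 0ℚ
    C = conv (terms z) (terms w) n

  partials : ℚ[i] → ℕ → ℚ[i]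
  partials z k = partial k z

  -- `partials w` are the prefix sums of `terms w`, so raising the index by one adds a term of `w`
  -- to each factor; the new last factor is `partial 0 w`, which is also `term 0 w`.
  conv-partials : ∀ f w n →
    conv f (partials w) (suc n) ≡ conv f (partials w) n ⊕ conv f (terms w) (suc n)
  conv-partials f w zero = solveᵍ 3 (λ a b u →
      a ⊠ (conᵍ 1ᵍ ⊞ u) ⊞ b ⊠ conᵍ 1ᵍ ⊜ a ⊠ conᵍ 1ᵍ ⊞ (a ⊠ u ⊞ b ⊠ conᵍ 1ᵍ)) refl
    (f 0) (f 1) (term 1 w)
  conv-partials f w (suc n) = trans
    (cong (f 0 ⊗ (partial (suc n) w ⊕ term (suc (suc n)) w) ⊕_) (conv-partials (shift f) w n))
    (solveᵍ 5 (λ a p t u v → a ⊠ (p ⊞ t) ⊞ (u ⊞ v) ⊜ (a ⊠ p ⊞ u) ⊞ (a ⊠ t ⊞ v)) refl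
      (f 0) (partial (suc n) w) (term (suc (suc n)) w)
      (conv (shift f) (partials w) n) (conv (shift f) (terms w) (suc n)))

  -- A sum over the triangle of index pairs of total degree at most `n`: the term of `z` of index i
  -- meets all terms of `w` up to index n - i.
  partial-⊕ : ∀ z w n → partial n (z ⊕ w) ≡ conv (terms z) (partials w) n
  partial-⊕ z w zero    = refl
  partial-⊕ z w (suc n) = trans (cong₂ _⊕_ (partial-⊕ z w n) (term-⊕ z w (suc n)))
    (sym (conv-partials (terms z) w n))

  -- `conv` splits off the first coefficient of `f`, whereas `partial` grows by the last one; this
  -- mediates between the two.
  conv-const-suc : ∀ f u n → conv f (λ _ → u) (suc n) ≡ conv f (λ _ → u) n ⊕ f (suc n) ⊗ u
  conv-const-suc f u zero    = refl
  conv-const-suc f u (suc n) = trans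
    (cong (f 0 ⊗ u ⊕_) (conv-const-suc (shift f) u n))
    (sym (⊕-assoc (f 0 ⊗ u) _ _))

  -- With `u = partial n w` this is the sum over the full square of index pairs, written as a
  -- convolution so that the triangle of `partial-⊕` can be subtracted from it factor by factor.
  conv-const : ∀ z u n → conv (terms z) (λ _ → u) n ≡ partial n z ⊗ u
  conv-const z u zero    = refl
  conv-const z u (suc n) = trans (conv-const-suc (terms z) u n)
    (trans (cong (_⊕ term (suc n) z ⊗ u) (conv-const z u n))
      (solveᵍ 3 (λ p t u → p ⊠ u ⊞ t ⊠ u ⊜ (p ⊞ t) ⊠ u) refl (partial n z) (term (suc n) z) u))

  conv-⊖ʳ : ∀ f g h n → conv f g n ⊖ conv f h n ≡ conv f (λ k → g k ⊖ h k) n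
  conv-⊖ʳ f g h zero = lem (f 0) (g 0) (h 0)
    where
    lem : ∀ a b c → a ⊗ b ⊖ a ⊗ c ≡ a ⊗ (b ⊖ c)
    lem a b c rewrite ⊖-neg (a ⊗ b) (a ⊗ c) | ⊖-neg b c =
      solveᵍ 3 (λ a b c → a ⊠ b ⊞ (⊟ (a ⊠ c)) ⊜ a ⊠ (b ⊞ (⊟ c))) refl a b c
  conv-⊖ʳ f g h (suc n) = trans
    (lem (f 0) (g (suc n)) (h (suc n)) (conv (shift f) g n) (conv (shift f) h n))
    (cong (f 0 ⊗ (g (suc n) ⊖ h (suc n)) ⊕_) (conv-⊖ʳ (shift f) g h n))
    where
    lem : ∀ a b c u v → (a ⊗ b ⊕ u) ⊖ (a ⊗ c ⊕ v) ≡ a ⊗ (b ⊖ c) ⊕ (u ⊖ v)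
    lem a b c u v rewrite ⊖-neg (a ⊗ b ⊕ u) (a ⊗ c ⊕ v) | ⊖-neg b c | ⊖-neg u v =
      solveᵍ 5 (λ a b c u v → (a ⊠ b ⊞ u) ⊞ (⊟ (a ⊠ c ⊞ v)) ⊜ a ⊠ (b ⊞ (⊟ c)) ⊞ (u ⊞ (⊟ v)))
        refl a b c u v

  -- Geometric bounds and the functional equation of the exponential

  pow≤1 : ∀ n → pow n ≤ 1ℚ
  pow≤1 zero    = ℚ.≤-refl
  pow≤1 (suc n) = *-mono {a = 4/5} {b = 1ℚ} (from-yes (0ℚ ≤? 4/5)) 0≤1 (from-yes (4/5 ≤? 1ℚ)) (pow≤1 n)

  pow-+ : ∀ m n → pow (m ℕ.+ n) ≡ pow m * pow n
  pow-+ zero    n = sym (ℚ.*-identityˡ (pow n))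
  pow-+ (suc m) n = trans (cong (4/5 *_) (pow-+ m n)) (sym (ℚ.*-assoc 4/5 (pow m) (pow n)))

  pow-antitone : ∀ m n → pow (m ℕ.+ n) ≤ pow n
  pow-antitone m n = begin
    pow (m ℕ.+ n)   ≡⟨ pow-+ m n ⟩
    pow m * pow n   ≤⟨ *-monoˡ (0≤pow n) (pow≤1 m) ⟩
    1ℚ * pow n      ≡⟨ ℚ.*-identityˡ (pow n) ⟩
    pow n           ∎
    where open ℚ.≤-Reasoning

  5/4 : ℚ
  5/4 = + 5 ℚ./ 4

  -- Enlarging the radius by 5/4, the reciprocal of the base of `pow`, extracts a geometric factor
  -- from the terms of the series.
  t-scale : ∀ B k → t B k ≡ pow k * t (5/4 * B) k
  t-scale B zero    = refl
  t-scale B (suc k) = trans (cong (λ u → recip k * (B * u)) (t-scale B k))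
    (solve 4 (λ r B p u → r :* (B :* (p :* u))
       := con 4/5 :* p :* (r :* (con 5/4 :* B :* u))) refl (recip k) B (pow k) (t (5/4 * B) k))

  0≤5/4* : ∀ {B} → 0ℚ ≤ B → 0ℚ ≤ 5/4 * B
  0≤5/4* = 0≤* {5/4} (from-yes (0ℚ ≤? 5/4))

  s-bound : ∀ {B} → 0ℚ ≤ B → ∃ λ K → 0ℚ ≤ K × (∀ n → s B n ≤ K)
  s-bound {B} 0≤B = s B N + (t B N + t B N) ,
      0≤+ (0≤s 0≤B N) (0≤+ (0≤t 0≤B N) (0≤t 0≤B N)) ,
      s-bounded 0≤B N (proj₂ (archimedean (B + B)))
    where N = proj₁ (archimedean (B + B))

  t≤s : ∀ {B} → 0ℚ ≤ B → ∀ n → t B n ≤ s B (suc n)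
  t≤s 0≤B n = ≤+ˡ (0≤s 0≤B n)

  -- On the common bound `A + B` for both arguments the partial sums of all lengths share one
  -- Lipschitz constant.
  exp-cong : ∀ {x y} → x ≈ y → exp x ≈ exp y
  exp-cong {x} {y} x≈y = choose-bounds (bounded x) (bounded y)
    where
    choose-bounds : Bounded x → Bounded y → exp x ≈ exp y
    choose-bounds (A , 0≤A , hA) (B , 0≤B , hB) = choose-K (s-bound 0≤A+B)
      where
      0≤A+B = 0≤+ 0≤A 0≤B
      choose-K : (∃ λ K → 0ℚ ≤ K × (∀ n → s (A + B) n ≤ K)) → exp x ≈ exp y
      choose-K (K , 0≤K , hK) = null-≤ (λ n → begin
          ∥ partial n (seq x n) ⊖ partial n (seq y n) ∥
            ≤⟨ partial-lipschitz 0≤A+B (ℚ.≤-trans (hA n) (≤+ʳ 0≤B)) (ℚ.≤-trans (hB n) (≤+ˡ 0≤A)) n ⟩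
          ∥ seq x n ⊖ seq y n ∥ * s (A + B) n
            ≤⟨ *-monoʳ (0≤∥∥ (seq x n ⊖ seq y n)) (hK n) ⟩
          ∥ seq x n ⊖ seq y n ∥ * K
            ≡⟨ ℚ.*-comm (∥ seq x n ⊖ seq y n ∥) K ⟩
          K * ∥ seq x n ⊖ seq y n ∥ ∎)
        (null-* 0≤K x≈y)
        where open ℚ.≤-Reasoning

  -- The ratio of consecutive bounds on f is the square of that on h, so that the
  -- i-th summand is at most A * K * pow n * pow i, and ∑ pow i ≤ 5.
  conv-bound : ∀ {A K} → 0ℚ ≤ A → 0ℚ ≤ K → ∀ f h n →
    (∀ k → ∥ f k ∥ ≤ A * (pow k * pow k)) → (∀ k → k ℕ.≤ n → ∥ h k ∥ ≤ K * pow k) →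
    ∥ conv f h n ∥ ≤ natℚ 5 * (A * K) * pow n
  conv-bound {A} {K} 0≤A 0≤K f h zero hf hh = begin
    ∥ f 0 ⊗ h 0 ∥                   ≤⟨ ∥⊗∥ (f 0) (h 0) ⟩
    ∥ f 0 ∥ * ∥ h 0 ∥
      ≤⟨ *-mono (0≤∥∥ (f 0)) (0≤* {K} {1ℚ} 0≤K 0≤1) (hf 0) (hh 0 z≤n) ⟩
    A * 1ℚ * (K * 1ℚ)
      ≡⟨ solve 2 (λ A K → A :* con 1ℚ :* (K :* con 1ℚ) := con 1ℚ :* (A :* K)) refl A K ⟩
    1ℚ * (A * K)
      ≤⟨ *-monoˡ (0≤* 0≤A 0≤K) (from-yes (1ℚ ≤? natℚ 5)) ⟩
    natℚ 5 * (A * K)                ≡⟨ ℚ.*-identityʳ _ ⟨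
    natℚ 5 * (A * K) * 1ℚ           ∎
    where open ℚ.≤-Reasoning
  conv-bound {A} {K} 0≤A 0≤K f h (suc n) hf hh = begin
    ∥ f 0 ⊗ h (suc n) ⊕ conv (shift f) h n ∥
      ≤⟨ ∥⊕∥ (f 0 ⊗ h (suc n)) (conv (shift f) h n) ⟩
    ∥ f 0 ⊗ h (suc n) ∥ + ∥ conv (shift f) h n ∥
      ≤⟨ ℚ.+-mono-≤
           (ℚ.≤-trans (∥⊗∥ (f 0) (h (suc n)))
             (*-mono (0≤∥∥ (f 0)) (0≤* 0≤K (0≤pow (suc n))) (hf 0) (hh (suc n) ℕ.≤-refl)))
           (conv-bound 0≤qA 0≤K (shift f) h n
             (λ k → ℚ.≤-trans (hf (suc k)) (ℚ.≤-reflexive (rescale (pow k))))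
             (λ k k≤n → hh k (ℕ.m≤n⇒m≤1+n k≤n))) ⟩
    A * 1ℚ * (K * (4/5 * pow n)) + natℚ 5 * (q * A * K) * pow n
      -- The coefficients are 4/5 and 5 * 16/25, whose sum 4 equals 5 * 4/5, so the constant 5
      -- reproduces itself.
      ≡⟨ solve 3 (λ A K p → A :* con 1ℚ :* (K :* (con 4/5 :* p)) :+ con (natℚ 5) :* (con q :* A :* K) :* p
           := con (natℚ 5) :* (A :* K) :* (con 4/5 :* p)) refl A K (pow n) ⟩
    natℚ 5 * (A * K) * (4/5 * pow n) ∎
    where
    open ℚ.≤-Reasoning
    q : ℚ
    q = + 16 ℚ./ 25
    0≤qA : 0ℚ ≤ q * A
    0≤qA = 0≤* {q} (from-yes (0ℚ ≤? q)) 0≤A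
    rescale : ∀ p → A * (4/5 * p * (4/5 * p)) ≡ q * A * (p * p)
    rescale p = solve 2 (λ A p → A :* (con 4/5 :* p :* (con 4/5 :* p)) := con q :* A :* (p :* p)) refl A p

  -- Each term beyond index `k` is at most `pow k` times the corresponding term for the radius
  -- `5/4 * B`, and the latter add up to at most `s`.
  partial-tail-pow : ∀ {B z} → 0ℚ ≤ B → ∥ z ∥ ≤ B → ∀ j k →
    ∥ partial (j ℕ.+ k) z ⊖ partial k z ∥ ≤ s (5/4 * B) (suc j ℕ.+ k) * pow k
  partial-tail-pow {B} {z} 0≤B hz zero k = begin
    ∥ partial k z ⊖ partial k z ∥   ≡⟨ ∥⊖∥-self (partial k z) ⟩
    0ℚ                              ≤⟨ 0≤* (0≤s (0≤5/4* 0≤B) (suc k)) (0≤pow k) ⟩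
    s (5/4 * B) (suc k) * pow k     ∎
    where open ℚ.≤-Reasoning
  partial-tail-pow {B} {z} 0≤B hz (suc j) k = begin
    ∥ (P ⊕ T) ⊖ partial k z ∥
      ≤⟨ ∥⊖∥-triangle (P ⊕ T) P (partial k z) ⟩
    ∥ (P ⊕ T) ⊖ P ∥ + ∥ P ⊖ partial k z ∥
      ≡⟨ cong (λ u → ∥ u ∥ + ∥ P ⊖ partial k z ∥) (cancel P T) ⟩
    ∥ T ∥ + ∥ P ⊖ partial k z ∥
      ≤⟨ ℚ.+-mono-≤ T-bound (partial-tail-pow 0≤B hz j k) ⟩
    t C n * pow k + s C n * pow k
      ≡⟨ solve 3 (λ a b p → a :* p :+ b :* p := (b :+ a) :* p) refl (t C n) (s C n) (pow k) ⟩
    (s C n + t C n) * pow k ∎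
    where
    open ℚ.≤-Reasoning
    n = suc j ℕ.+ k
    C = 5/4 * B
    P = partial (j ℕ.+ k) z
    T = term n z
    cancel : ∀ a b → (a ⊕ b) ⊖ a ≡ b
    cancel (a +i a′) (b +i b′) = cong₂ _+i_ (lem a b) (lem a′ b′)
      where lem = solve 2 (λ a b → a :+ b :- a := b) refl
    T-bound : ∥ T ∥ ≤ t C n * pow k
    T-bound = begin
      ∥ T ∥             ≤⟨ term-bound 0≤B n {z} hz ⟩
      t B n             ≡⟨ t-scale B n ⟩
      pow n * t C n     ≤⟨ *-monoˡ (0≤t (0≤5/4* 0≤B) n) (pow-antitone (suc j) k) ⟩
      pow k * t C n     ≡⟨ ℚ.*-comm (pow k) (t C n) ⟩
      t C n * pow k     ∎

  -- Triangle minus square is the convolution of the terms of `z` with the tails of the series of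
  -- `w`. The terms decay like `pow k * pow k` and the tails like `pow k`, which is the situation of
  -- `conv-bound`.
  exp-+ : ∀ x y → exp (x +ᶜ y) ≈ exp x *ᶜ exp y
  exp-+ x y = choose-bounds (bounded x) (bounded y)
    where
    choose-bounds : Bounded x → Bounded y → exp (x +ᶜ y) ≈ exp x *ᶜ exp y
    choose-bounds (X , 0≤X , hX) (Y , 0≤Y , hY) = choose-K (s-bound 0≤X″) (s-bound (0≤5/4* 0≤Y))
      where
      -- The radius is enlarged twice, once for each factor `pow k` to be extracted from the terms.
      0≤X″ = 0≤5/4* (0≤5/4* 0≤X)
      choose-K : (∃ λ A → 0ℚ ≤ A × (∀ n → s (5/4 * (5/4 * X)) n ≤ A)) →
                 (∃ λ K → 0ℚ ≤ K × (∀ n → s (5/4 * Y) n ≤ K)) →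
                 exp (x +ᶜ y) ≈ exp x *ᶜ exp y
      choose-K (A , 0≤A , hA) (K , 0≤K , hK) = null-≤ bound
          (null-pow (0≤* {natℚ 5} (from-yes (0ℚ ≤? natℚ 5)) (0≤* 0≤A 0≤K)))
        where
        open ℚ.≤-Reasoning
        bound : ∀ n → ∥ partial n (seq x n ⊕ seq y n) ⊖ partial n (seq x n) ⊗ partial n (seq y n) ∥
                      ≤ natℚ 5 * (A * K) * pow n
        bound n = begin
          ∥ partial n (z ⊕ w) ⊖ partial n z ⊗ partial n w ∥
            ≡⟨ cong ∥_∥ (cong₂ _⊖_ (partial-⊕ z w n) (sym (conv-const z (partial n w) n))) ⟩
          ∥ conv (terms z) (partials w) n ⊖ conv (terms z) (λ _ → partial n w) n ∥
            ≡⟨ cong ∥_∥ (conv-⊖ʳ (terms z) (partials w) (λ _ → partial n w) n) ⟩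
          ∥ conv (terms z) (λ k → partial k w ⊖ partial n w) n ∥
            ≤⟨ conv-bound 0≤A 0≤K (terms z) (λ k → partial k w ⊖ partial n w) n term-≤ tail-≤ ⟩
          natℚ 5 * (A * K) * pow n ∎
          where
          z = seq x n
          w = seq y n
          term-≤ : ∀ k → ∥ term k z ∥ ≤ A * (pow k * pow k)
          term-≤ k = begin
            ∥ term k z ∥                               ≤⟨ term-bound 0≤X k (hX n) ⟩
            t X k                                      ≡⟨ t-scale X k ⟩
            pow k * t (5/4 * X) k                      ≡⟨ cong (pow k *_) (t-scale (5/4 * X) k) ⟩
            pow k * (pow k * t (5/4 * (5/4 * X)) k)
              ≡⟨ solve 2 (λ p u → p :* (p :* u) := u :* (p :* p)) refl (pow k) (t (5/4 * (5/4 * X)) k) ⟩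
            t (5/4 * (5/4 * X)) k * (pow k * pow k)
              ≤⟨ *-monoˡ (0≤* (0≤pow k) (0≤pow k)) (ℚ.≤-trans (t≤s 0≤X″ k) (hA (suc k))) ⟩
            A * (pow k * pow k)                        ∎
          tail-≤ : ∀ k → k ℕ.≤ n → ∥ partial k w ⊖ partial n w ∥ ≤ K * pow k
          tail-≤ k k≤n = begin
            ∥ partial k w ⊖ partial n w ∥
              ≡⟨ ∥⊖∥-sym (partial k w) (partial n w) ⟩
            ∥ partial n w ⊖ partial k w ∥
              ≡⟨ cong (λ m → ∥ partial m w ⊖ partial k w ∥) (ℕ.m∸n+n≡m k≤n) ⟨
            ∥ partial (n ℕ.∸ k ℕ.+ k) w ⊖ partial k w ∥
              ≤⟨ partial-tail-pow 0≤Y (hY n) (n ℕ.∸ k) k ⟩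
            s (5/4 * Y) (suc (n ℕ.∸ k) ℕ.+ k) * pow k
              ≤⟨ *-monoˡ (0≤pow k) (hK (suc (n ℕ.∸ k) ℕ.+ k)) ⟩
            K * pow k ∎

  term-0 : ∀ k → term (suc k) 0ᵍ ≡ 0ᵍ
  term-0 k = trans (cong (recip k •_) (lem (term k 0ᵍ)))
      (cong₂ _+i_ (ℚ.*-zeroʳ (recip k)) (ℚ.*-zeroʳ (recip k)))
    where
    lem : ∀ z → 0ᵍ ⊗ z ≡ 0ᵍ
    lem (a +i b) = cong₂ _+i_
      (solve 2 (λ a b → con 0ℚ :* a :- con 0ℚ :* b := con 0ℚ) refl a b)
      (solve 2 (λ a b → con 0ℚ :* b :+ con 0ℚ :* a := con 0ℚ) refl a b)

  partial-0 : ∀ n → partial n 0ᵍ ≡ 1ᵍ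
  partial-0 zero    = refl
  partial-0 (suc n) = cong₂ _⊕_ (partial-0 n) (term-0 n)

  exp-0 : exp 0ᶜ ≈ 1ᶜ
  exp-0 = pointwise {exp 0ᶜ} {1ᶜ} partial-0

  -- The exponential at iπ/2 and at 2πi

  conj : ℚ[i] → ℚ[i]
  conj (a +i b) = a +i (- b)

  -- The coefficients of the exponential series are real.
  term-conj : ∀ k z → term k (conj z) ≡ conj (term k z)
  term-conj zero    z = refl
  term-conj (suc k) z = trans (cong (λ u → recip k • (conj z ⊗ u)) (term-conj k z))
      (lem (recip k) z (term k z))
    where
    lem : ∀ r z w → r • (conj z ⊗ conj w) ≡ conj (r • (z ⊗ w))
    lem r (a +i b) (c +i d) = cong₂ _+i_
      (solve 5 (λ r a b c d → r :* (a :* c :- (:- b) :* (:- d))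
        := r :* (a :* c :- b :* d)) refl r a b c d)
      (solve 5 (λ r a b c d → r :* (a :* (:- d) :+ (:- b) :* c)
        := :- (r :* (a :* d :+ b :* c))) refl r a b c d)

  partial-conj : ∀ n z → partial n (conj z) ≡ conj (partial n z)
  partial-conj zero    z = refl
  partial-conj (suc n) z = trans (cong₂ _⊕_ (partial-conj n z) (term-conj (suc n) z))
    (lem (partial n z) (term (suc n) z))
    where
    lem : ∀ z w → conj z ⊕ conj w ≡ conj (z ⊕ w)
    lem (a +i b) (c +i d) = cong (a + c +i_) (sym (ℚ.neg-distrib-+ b d))

  delay : ℕ → ℂ → ℂ
  delay k x .seq n = seq x (n ℕ.∸ k)
  delay k x .cauchy ε 0<ε = N ℕ.+ k , λ m n hm hn →
      proj₂ (cauchy x ε 0<ε) (m ℕ.∸ k) (n ℕ.∸ k) (ℕ.m+n≤o⇒m≤o∸n N hm) (ℕ.m+n≤o⇒m≤o∸n N hn)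
    where N = proj₁ (cauchy x ε 0<ε)

  delay-≈ : ∀ k x → delay k x ≈ x
  delay-≈ k x ε 0<ε = N ℕ.+ k , λ n h →
      proj₂ (cauchy x ε 0<ε) (n ℕ.∸ k) n (ℕ.m+n≤o⇒m≤o∸n N h) (ℕ.≤-trans (ℕ.m≤m+n N k) h)
    where N = proj₁ (cauchy x ε 0<ε)

  neg1ᶜ : ℂ
  neg1ᶜ = fromℚ (- 1ℚ)

  -- delayed, so that the n + 5-th approximation of exp iπ/2 is the truncated series
  -- at half-πₙ n whose real part is the step of the iteration defining half-πₙ
  iπ/2 : ℂ
  iπ/2 = delay 5 (half-π *ᶜ i)

  iπ/2-seq : ∀ n → seq iπ/2 n ≡ 0ℚ +i half-πₙ (n ℕ.∸ 5)
  iπ/2-seq n = cong₂ _+i_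
    (solve 1 (λ x → x :* con 0ℚ :- con 0ℚ :* con 1ℚ := con 0ℚ) refl (half-πₙ (n ℕ.∸ 5)))
    (solve 1 (λ x → x :* con 1ℚ :+ con 0ℚ :* con 0ℚ := x) refl (half-πₙ (n ℕ.∸ 5)))

  -- At index `n + 5` the real part is the increment `half-πₙ (suc n) - half-πₙ n`, which
  -- `half-π-step` bounds by `pow n`. The factor 2 comes from conj z + z = 2 re z.
  re-exp-iπ/2-null : Null (λ n → natℚ 2 * ∣ re (seq (exp iπ/2) n) ∣)
  re-exp-iπ/2-null = null-* {natℚ 2} {λ n → ∣ re (seq (exp iπ/2) n) ∣} (from-yes (0ℚ ≤? natℚ 2))
      (null-unshift 5 {λ n → ∣ re (seq (exp iπ/2) n) ∣} (null-≤ bound (null-pow 0≤1)))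
    where
    open ℚ.≤-Reasoning
    bound : ∀ n → ∣ re (seq (exp iπ/2) (n ℕ.+ 5)) ∣ ≤ 1ℚ * pow n
    bound n = begin
      ∣ re (partial (n ℕ.+ 5) (seq iπ/2 (n ℕ.+ 5))) ∣
        ≡⟨ cong (λ z → ∣ re (partial (n ℕ.+ 5) z) ∣) (iπ/2-seq (n ℕ.+ 5)) ⟩
      ∣ cosₙ (n ℕ.+ 5) (half-πₙ (n ℕ.+ 5 ℕ.∸ 5)) ∣
        ≡⟨ cong (λ m → ∣ cosₙ (n ℕ.+ 5) (half-πₙ m) ∣) (ℕ.m+n∸n≡m n 5) ⟩
      ∣ cosₙ (n ℕ.+ 5) (half-πₙ n) ∣
        ≡⟨ cong ∣_∣ (solve 2 (λ x y → y := x :+ y :- x) refl (half-πₙ n) (cosₙ (n ℕ.+ 5) (half-πₙ n))) ⟩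
      ∣ half-πₙ (suc n) - half-πₙ n ∣
        ≤⟨ half-π-step n ⟩
      pow n
        ≡⟨ ℚ.*-identityˡ (pow n) ⟨
      1ℚ * pow n ∎

  -- Every approximation of `iπ/2` is purely imaginary, so negating the argument conjugates the
  -- partial sum z; the distance from conj z to - z is twice the absolute value of re z.
  exp-neg-iπ/2 : exp (neg1ᶜ *ᶜ iπ/2) ≈ neg1ᶜ *ᶜ exp iπ/2
  exp-neg-iπ/2 = null-≤ (λ n → ℚ.≤-reflexive (trans
      (cong (λ u → ∥ u ⊖ (- 1ℚ +i 0ℚ) ⊗ seq (exp iπ/2) n ∥)
        (trans (cong (partial n) (neg-iπ/2 n)) (partial-conj n (seq iπ/2 n))))
      (conj-⊖-neg (seq (exp iπ/2) n))))
    re-exp-iπ/2-null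
    where
    neg-iπ/2 : ∀ n → (- 1ℚ +i 0ℚ) ⊗ seq iπ/2 n ≡ conj (seq iπ/2 n)
    neg-iπ/2 n = trans (cong ((- 1ℚ +i 0ℚ) ⊗_) (iπ/2-seq n))
      (trans (cong₂ _+i_
          (solve 1 (λ x → con (- 1ℚ) :* con 0ℚ :- con 0ℚ :* x := con 0ℚ) refl (half-πₙ (n ℕ.∸ 5)))
          (solve 1 (λ x → con (- 1ℚ) :* x :+ con 0ℚ :* con 0ℚ := :- x) refl (half-πₙ (n ℕ.∸ 5))))
        (cong conj (sym (iπ/2-seq n))))
    conj-⊖-neg : ∀ z → ∥ conj z ⊖ (- 1ℚ +i 0ℚ) ⊗ z ∥ ≡ natℚ 2 * ∣ re z ∣
    conj-⊖-neg (a +i b) = trans (cong₂ (λ x y → ∣ x ∣ + ∣ y ∣)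
        (solve 2 (λ a b → a :- (con (- 1ℚ) :* a :- con 0ℚ :* b) := con (natℚ 2) :* a) refl a b)
        (solve 2 (λ a b → :- b :- (con (- 1ℚ) :* b :+ con 0ℚ :* a) := con 0ℚ) refl a b))
      (trans (ℚ.+-identityʳ _) (ℚ.∣p*q∣≡∣p∣*∣q∣ (natℚ 2) a))

  exp-iπ/2² : exp iπ/2 *ᶜ exp iπ/2 ≈ neg1ᶜ
  exp-iπ/2² = begin
    e *ᶜ e
      ≈⟨ pointwise {e *ᶜ e} {neg1ᶜ *ᶜ (e *ᶜ (neg1ᶜ *ᶜ e))} (λ n → double-neg (seq e n)) ⟩
    neg1ᶜ *ᶜ (e *ᶜ (neg1ᶜ *ᶜ e))
      ≈⟨ *ᶜ-cong {neg1ᶜ} {neg1ᶜ} {e *ᶜ (neg1ᶜ *ᶜ e)} {1ᶜ} (≈-refl {neg1ᶜ}) e*-e ⟩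
    neg1ᶜ *ᶜ 1ᶜ
      ≈⟨ pointwise {neg1ᶜ *ᶜ 1ᶜ} {neg1ᶜ} (λ n → refl) ⟩
    neg1ᶜ ∎
    where
    open ≈-Reasoning
    e = exp iπ/2
    -iπ/2 = neg1ᶜ *ᶜ iπ/2
    double-neg : ∀ z → z ⊗ z ≡ (- 1ℚ +i 0ℚ) ⊗ (z ⊗ ((- 1ℚ +i 0ℚ) ⊗ z))
    double-neg = solveᵍ 1 (λ z → z ⊠ z ⊜ conᵍ (- 1ℚ +i 0ℚ) ⊠ (z ⊠ (conᵍ (- 1ℚ +i 0ℚ) ⊠ z))) refl
    add-neg : ∀ z → z ⊕ (- 1ℚ +i 0ℚ) ⊗ z ≡ 0ᵍ
    add-neg = solveᵍ 1 (λ z → z ⊞ conᵍ (- 1ℚ +i 0ℚ) ⊠ z ⊜ conᵍ 0ᵍ) refl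
    e*-e : e *ᶜ (neg1ᶜ *ᶜ e) ≈ 1ᶜ
    e*-e = begin
      e *ᶜ (neg1ᶜ *ᶜ e)
        ≈⟨ *ᶜ-cong {e} {e} {exp -iπ/2} {neg1ᶜ *ᶜ e} (≈-refl {e}) exp-neg-iπ/2 ⟨
      e *ᶜ exp -iπ/2
        ≈⟨ exp-+ iπ/2 -iπ/2 ⟨
      exp (iπ/2 +ᶜ -iπ/2)
        ≈⟨ exp-cong {iπ/2 +ᶜ -iπ/2} {0ᶜ}
             (pointwise {iπ/2 +ᶜ -iπ/2} {0ᶜ} (λ n → add-neg (seq iπ/2 n))) ⟩
      exp 0ᶜ
        ≈⟨ exp-0 ⟩
      1ᶜ ∎

  -- `2πi` is the sum of four copies of `half-π *ᶜ i`, so its exponential is the square of - 1.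
  exp-2πi : exp 2πi ≈ 1ᶜ
  exp-2πi = begin
    exp 2πi
      ≈⟨ exp-cong {2πi} {(v +ᶜ v) +ᶜ (v +ᶜ v)}
           (pointwise {2πi} {(v +ᶜ v) +ᶜ (v +ᶜ v)} λ n → quarters (seq half-π n)) ⟩
    exp ((v +ᶜ v) +ᶜ (v +ᶜ v))
      ≈⟨ exp-+ (v +ᶜ v) (v +ᶜ v) ⟩
    exp (v +ᶜ v) *ᶜ exp (v +ᶜ v)
      ≈⟨ *ᶜ-cong {exp (v +ᶜ v)} {neg1ᶜ} {exp (v +ᶜ v)} {neg1ᶜ} exp-2v exp-2v ⟩
    neg1ᶜ *ᶜ neg1ᶜ
      ≈⟨ pointwise {neg1ᶜ *ᶜ neg1ᶜ} {1ᶜ} (λ n → refl) ⟩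
    1ᶜ ∎
    where
    open ≈-Reasoning
    v = half-π *ᶜ i
    quarters : ∀ h → ((natℚ 2 +i 0ℚ) ⊗ ((natℚ 2 +i 0ℚ) ⊗ h)) ⊗ iᵍ ≡ (h ⊗ iᵍ ⊕ h ⊗ iᵍ) ⊕ (h ⊗ iᵍ ⊕ h ⊗ iᵍ)
    quarters = solveᵍ 1 (λ h → (conᵍ (natℚ 2 +i 0ℚ) ⊠ (conᵍ (natℚ 2 +i 0ℚ) ⊠ h)) ⊠ conᵍ iᵍ
      ⊜ (h ⊠ conᵍ iᵍ ⊞ h ⊠ conᵍ iᵍ) ⊞ (h ⊠ conᵍ iᵍ ⊞ h ⊠ conᵍ iᵍ)) refl
    exp-v : exp v ≈ exp iπ/2
    exp-v = exp-cong {v} {iπ/2} (≈-sym {iπ/2} {v} (delay-≈ 5 v))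
    exp-2v : exp (v +ᶜ v) ≈ neg1ᶜ
    exp-2v = begin
      exp (v +ᶜ v)      ≈⟨ exp-+ v v ⟩
      exp v *ᶜ exp v    ≈⟨ *ᶜ-cong {exp v} {exp iπ/2} {exp v} {exp iπ/2} exp-v exp-v ⟩
      exp iπ/2 *ᶜ exp iπ/2
                        ≈⟨ exp-iπ/2² ⟩
      neg1ᶜ             ∎

  -- Roots of unity

  ζ : (n : ℕ) .{{_ : NonZero n}} → ℕ → ℂ
  ζ n a = exp (2πi *ᶜ fromℚ (+ a ℚ./ n))

  +-/ : ∀ a n .{{_ : NonZero n}} → + (a ℕ.+ n) ℚ./ n ≡ + a ℚ./ n + 1ℚ
  +-/ a (suc k) = ℚ.toℚᵘ-injective
    (ℚᵘ.≃-trans (toℚᵘ-/ (+ (a ℕ.+ suc k)) k)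
    (ℚᵘ.≃-trans (*≡* (cong₂ ℤ._*_ eq (cong +_ (ℕ.*-identityʳ (suc k)))))
    (ℚᵘ.≃-sym (ℚᵘ.≃-trans (ℚ.toℚᵘ-homo-+ (+ a ℚ./ suc k) 1ℚ)
                          (ℚᵘ.+-cong (toℚᵘ-/ (+ a) k) ℚᵘ.≃-refl)))))
    where
    eq : + (a ℕ.+ suc k) ≡ + a ℤ.* + 1 ℤ.+ + 1 ℤ.* + suc k
    eq = cong₂ ℤ._+_ (sym (ℤ.*-identityʳ (+ a))) (sym (ℤ.*-identityˡ (+ suc k)))

  ζ-periodic : ∀ n .{{_ : NonZero n}} a → ζ n (a ℕ.+ n) ≈ ζ n a
  ζ-periodic n a = begin
    exp (2πi *ᶜ fromℚ (+ (a ℕ.+ n) ℚ./ n))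
      ≡⟨ cong (λ q → exp (2πi *ᶜ fromℚ q)) (+-/ a n) ⟩
    exp (2πi *ᶜ fromℚ (q + 1ℚ))
      ≈⟨ exp-cong {2πi *ᶜ fromℚ (q + 1ℚ)} {2πi *ᶜ fromℚ q +ᶜ 2πi}
           (pointwise {2πi *ᶜ fromℚ (q + 1ℚ)} {2πi *ᶜ fromℚ q +ᶜ 2πi} λ k → distrib (seq 2πi k)) ⟩
    exp (2πi *ᶜ fromℚ q +ᶜ 2πi)
      ≈⟨ exp-+ (2πi *ᶜ fromℚ q) 2πi ⟩
    ζ n a *ᶜ exp 2πi
      ≈⟨ *ᶜ-cong {ζ n a} {ζ n a} {exp 2πi} {1ᶜ} (≈-refl {ζ n a}) exp-2πi ⟩
    ζ n a *ᶜ 1ᶜ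
      ≈⟨ pointwise {ζ n a *ᶜ 1ᶜ} {ζ n a}
             (λ k → trans (⊗-comm (seq (ζ n a) k) 1ᵍ) (⊗-identityˡ (seq (ζ n a) k))) ⟩
    ζ n a ∎
    where
    open ≈-Reasoning
    q = + a ℚ./ n
    distrib : ∀ z → z ⊗ ((q + 1ℚ) +i 0ℚ) ≡ z ⊗ (q +i 0ℚ) ⊕ z
    distrib z = solveᵍ 2 (λ z q → z ⊠ (q ⊞ conᵍ 1ᵍ) ⊜ z ⊠ q ⊞ z) refl z (q +i 0ℚ)

-- Finite sums and the arithmetic of Ramanujan sums

open import Data.Nat using (_+_; _*_; _<_; _≤_; _%_; pred)
open import Data.Nat.Solver using (module +-*-Solver)
open +-*-Solver using (solve; _:+_; _:*_; _:=_; con)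

+ᶜ-comm : ∀ x y → x +ᶜ y ≈ y +ᶜ x
+ᶜ-comm x y = pointwise {x +ᶜ y} {y +ᶜ x} (λ n → ⊕-comm (seq x n) (seq y n))

+ᶜ-assoc : ∀ x y z → (x +ᶜ y) +ᶜ z ≈ x +ᶜ (y +ᶜ z)
+ᶜ-assoc x y z = pointwise {(x +ᶜ y) +ᶜ z} {x +ᶜ (y +ᶜ z)} (λ n → ⊕-assoc (seq x n) (seq y n) (seq z n))

+ᶜ-identityˡ : ∀ x → 0ᶜ +ᶜ x ≈ x
+ᶜ-identityˡ x = pointwise {0ᶜ +ᶜ x} {x} (λ n → ⊕-identityˡ (seq x n))

module _ {X : Set} where

  ∑-cong : ∀ xs {f g : X → ℂ} → (∀ {x} → x ∈ xs → f x ≈ g x) → ∑ xs f ≈ ∑ xs g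
  ∑-cong []       f≈g = ≈-refl {0ᶜ}
  ∑-cong (x ∷ xs) {f} {g} f≈g =
    +ᶜ-cong {f x} {g x} {∑ xs f} {∑ xs g} (f≈g (here refl)) (∑-cong xs {f} {g} (f≈g ∘ there))

  ∏-cong : ∀ xs {f g : X → ℂ} → (∀ x → f x ≈ g x) → ∏ xs f ≈ ∏ xs g
  ∏-cong []       f≈g = ≈-refl {1ᶜ}
  ∏-cong (x ∷ xs) {f} {g} f≈g =
    *ᶜ-cong {f x} {g x} {∏ xs f} {∏ xs g} (f≈g x) (∏-cong xs {f} {g} f≈g)

  ∑-++ : ∀ xs ys (f : X → ℂ) → ∑ (xs ++ ys) f ≈ ∑ xs f +ᶜ ∑ ys f
  ∑-++ []       ys f = ≈-sym {0ᶜ +ᶜ ∑ ys f} {∑ ys f} (+ᶜ-identityˡ (∑ ys f))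
  ∑-++ (x ∷ xs) ys f = begin
    f x +ᶜ ∑ (xs ++ ys) f
      ≈⟨ +ᶜ-cong {f x} {f x} {∑ (xs ++ ys) f} {∑ xs f +ᶜ ∑ ys f} (≈-refl {f x}) (∑-++ xs ys f) ⟩
    f x +ᶜ (∑ xs f +ᶜ ∑ ys f)
      ≈⟨ +ᶜ-assoc (f x) (∑ xs f) (∑ ys f) ⟨
    (f x +ᶜ ∑ xs f) +ᶜ ∑ ys f ∎
    where open ≈-Reasoning

  ∑-↭ : ∀ {xs ys} (f : X → ℂ) → xs ↭ ys → ∑ xs f ≈ ∑ ys f
  ∑-↭ {xs} f ↭.refl = ≈-refl {∑ xs f}
  ∑-↭ {x ∷ xs} {_ ∷ ys} f (prep _ p) =
    +ᶜ-cong {f x} {f x} {∑ xs f} {∑ ys f} (≈-refl {f x}) (∑-↭ f p)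
  ∑-↭ {x ∷ y ∷ xs} {_ ∷ _ ∷ ys} f (swap _ _ p) = begin
    f x +ᶜ (f y +ᶜ ∑ xs f)
      ≈⟨ +ᶜ-assoc (f x) (f y) (∑ xs f) ⟨
    (f x +ᶜ f y) +ᶜ ∑ xs f
      ≈⟨ +ᶜ-cong {f x +ᶜ f y} {f y +ᶜ f x} {∑ xs f} {∑ ys f}
           (+ᶜ-comm (f x) (f y)) (∑-↭ f p) ⟩
    (f y +ᶜ f x) +ᶜ ∑ ys f
      ≈⟨ +ᶜ-assoc (f y) (f x) (∑ ys f) ⟩
    f y +ᶜ (f x +ᶜ ∑ ys f) ∎
    where open ≈-Reasoning
  ∑-↭ {xs} {zs} f (↭.trans {ys = ys} p q) =
    ≈-trans {∑ xs f} {∑ ys f} {∑ zs f} (∑-↭ f p) (∑-↭ f q)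

  ∑-const : ∀ (xs : List X) z → ∑ xs (λ _ → z) ≈ z *ᶜ fromℚ (natℚ (length xs))
  ∑-const [] z = pointwise {0ᶜ} {z *ᶜ fromℚ 0ℚ} λ n →
    sym (trans (⊗-comm (seq z n) 0ᵍ) (trans (sym (•-⊗ 0ℚ (seq z n))) (0• (seq z n))))
    where
    0• : ∀ z → 0ℚ • z ≡ 0ᵍ
    0• (a +i b) = cong₂ _+i_ (ℚ.*-zeroˡ a) (ℚ.*-zeroˡ b)
  ∑-const (_ ∷ xs) z = begin
    z +ᶜ ∑ xs (λ _ → z)
      ≈⟨ +ᶜ-cong {z} {z} {∑ xs (λ _ → z)} {z *ᶜ fromℚ (natℚ k)} (≈-refl {z}) (∑-const xs z) ⟩
    z +ᶜ z *ᶜ fromℚ (natℚ k)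
      ≈⟨ pointwise {z +ᶜ z *ᶜ fromℚ (natℚ k)} {z *ᶜ fromℚ (natℚ (suc k))} (λ n → lem (seq z n)) ⟩
    z *ᶜ fromℚ (natℚ (suc k)) ∎
    where
    open ≈-Reasoning
    k = length xs
    lem : ∀ z → z ⊕ z ⊗ (natℚ k +i 0ℚ) ≡ z ⊗ (natℚ (suc k) +i 0ℚ)
    lem z = sym (trans (cong (z ⊗_) (natᵍ-suc k)) (trans (⊗-distribˡ z (natℚ k +i 0ℚ) 1ᵍ)
      (trans (cong (z ⊗ (natℚ k +i 0ℚ) ⊕_) (trans (⊗-comm z 1ᵍ) (⊗-identityˡ z)))
             (⊕-comm (z ⊗ (natℚ k +i 0ℚ)) z))))

∑-concatMap : ∀ {X Y : Set} (L : X → List Y) xs (f : Y → ℂ) →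
  ∑ (concatMap L xs) f ≈ ∑ xs (λ x → ∑ (L x) f)
∑-concatMap L []       f = ≈-refl {0ᶜ}
∑-concatMap L (x ∷ xs) f = ≈-trans
  {∑ (L x ++ concatMap L xs) f} {∑ (L x) f +ᶜ ∑ (concatMap L xs) f} {∑ (x ∷ xs) g}
  (∑-++ (L x) (concatMap L xs) f)
  (+ᶜ-cong {∑ (L x) f} {∑ (L x) f} {∑ (concatMap L xs) f} {∑ xs g}
    (≈-refl {∑ (L x) f}) (∑-concatMap L xs f))
  where g = λ x → ∑ (L x) f

∑-map : ∀ {X Y : Set} (σ : X → Y) xs (f : Y → ℂ) → ∑ (map σ xs) f ≡ ∑ xs (f ∘ σ)
∑-map σ []       f = refl
∑-map σ (x ∷ xs) f = cong (f (σ x) +ᶜ_) (∑-map σ xs f)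

module _ {X Y : Set} {xs : List X} {ys : List Y} (σ : X → Y) (τ : Y → X)
         (τσ : ∀ {x} → x ∈ xs → τ (σ x) ≡ x) where

  map-unique : Unique xs → Unique (map σ xs)
  map-unique = go xs τσ
    where
    go : ∀ xs → (∀ {x} → x ∈ xs → τ (σ x) ≡ x) → Unique xs → Unique (map σ xs)
    go []       inv []        = []
    go (x ∷ xs) inv (x∉ ∷ uq) = All.map⁺ (All.tabulate λ {y} y∈ σx≡σy →
        All.lookup x∉ y∈ (trans (sym (inv (here refl))) (trans (cong τ σx≡σy) (inv (there y∈)))))
      ∷ go xs (inv ∘ there) uq

  -- Duplicate-free lists with the same elements are permutations of each other, so it is enough
  -- that `σ` and `τ` are inverse to each other on the two lists.
  map-↭ : Unique xs → Unique ys → (∀ {x} → x ∈ xs → σ x ∈ ys) → (∀ {y} → y ∈ ys → τ y ∈ xs) →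
    (∀ {y} → y ∈ ys → σ (τ y) ≡ y) → map σ xs ↭ ys
  map-↭ uxs uys σ∈ τ∈ στ = ∼bag⇒↭ (unique∧set⇒bag (map-unique uxs) uys (mk⇔ to from))
    where
    to : ∀ {y} → y ∈ map σ xs → y ∈ ys
    to y∈ with ∈-map⁻ σ y∈
    ... | x , x∈ , refl = σ∈ x∈
    from : ∀ {y} → y ∈ ys → y ∈ map σ xs
    from y∈ = subst (_∈ map σ xs) (στ y∈) (∈-map⁺ σ (τ∈ y∈))

-- Totatives, residues and units modulo n

∈[1⋯]⁺ : ∀ {j n} → 0 < j → j ≤ n → j ∈ [1⋯ n ]
∈[1⋯]⁺ {suc j} _ j<n = ∈-applyUpTo⁺ suc j<n

∈[1⋯]⁻ : ∀ {j n} → j ∈ [1⋯ n ] → 0 < j × j ≤ n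
∈[1⋯]⁻ j∈ with ∈-applyUpTo⁻ suc j∈
... | _ , i<n , refl = s≤s z≤n , i<n

[1⋯]-unique : ∀ n → Unique [1⋯ n ]
[1⋯]-unique n = Unique.applyUpTo⁺₁ suc n (λ i<j _ 1+i≡1+j → ℕ.<⇒≢ i<j (ℕ.suc-injective 1+i≡1+j))

∈-totatives⁺ : ∀ {j n} → 0 < j → j ≤ n → Coprime j n → j ∈ totatives n
∈-totatives⁺ {n = n} 0<j j≤n cop = ∈-filter⁺ (λ j → gcd j n ℕ.≟ 1) (∈[1⋯]⁺ 0<j j≤n) (coprime⇒gcd≡1 cop)

∈-totatives⁻ : ∀ {j n} → j ∈ totatives n → 0 < j × j ≤ n × Coprime j n
∈-totatives⁻ {j} {n} j∈ with ∈-filter⁻ (λ j → gcd j n ℕ.≟ 1) {xs = [1⋯ n ]} j∈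
... | j∈[1⋯n] , gcd≡1 = proj₁ (∈[1⋯]⁻ j∈[1⋯n]) , proj₂ (∈[1⋯]⁻ {j} {n} j∈[1⋯n]) , gcd≡1⇒coprime gcd≡1

totatives-unique : ∀ n → Unique (totatives n)
totatives-unique n = Unique.filter⁺ (λ j → gcd j n ℕ.≟ 1) ([1⋯]-unique n)

coprime-∣ʳ : ∀ {a m n} → m ∣ n → Coprime a n → Coprime a m
coprime-∣ʳ m∣n cop (d∣a , d∣m) = cop (d∣a , ∣-trans d∣m m∣n)

coprime-* : ∀ {a b n} → Coprime a n → Coprime b n → Coprime (a * b) n
coprime-* ca cb (d∣ab , d∣n) =
  cb (coprime-divisor (λ (e∣d , e∣a) → ca (e∣a , ∣-trans e∣d d∣n)) d∣ab , d∣n)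

module _ (n : ℕ) .{{_ : NonZero n}} where

  -- Residues are taken in 1 … n, as in totatives; rep 0 is junk.
  rep : ℕ → ℕ
  rep a = suc (pred a % n)

  rep≤ : ∀ a → rep a ≤ n
  rep≤ a = m%n<n (pred a) n

  rep-≡ : ∀ a → 0 < a → a ≡ rep a + pred a / n * n
  rep-≡ (suc a) _ = cong suc (m≡m%n+[m/n]*n a n)

  rep-+ : ∀ a q → 0 < a → rep (a + q * n) ≡ rep a
  rep-+ (suc a) q _ = cong suc ([m+kn]%n≡m%n a q n)

  rep-id : ∀ {j} → 0 < j → j ≤ n → rep j ≡ j
  rep-id {suc j} _ j<n = cong suc (m<n⇒m%n≡m j<n)

  coprime-rep : ∀ a → 0 < a → Coprime a n → Coprime (rep a) n
  coprime-rep a 0<a cop (d∣r , d∣n) =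
    cop (subst (_ ∣_) (sym (rep-≡ a 0<a)) (∣m∣n⇒∣m+n d∣r (∣n⇒∣m*n (pred a / n) d∣n)) , d∣n)

  ∈-rep : ∀ {j u} → 0 < u → Coprime u n → j ∈ totatives n → rep (j * u) ∈ totatives n
  ∈-rep {j} {u} 0<u u⊥n j∈ with ∈-totatives⁻ j∈
  ... | 0<j , j≤n , j⊥n = ∈-totatives⁺ (s≤s z≤n) (rep≤ (j * u))
    (coprime-rep (j * u) (ℕ.*-mono-≤ 0<j 0<u) (coprime-* j⊥n u⊥n))

  -- Reducing before the second multiplication changes the product only by a multiple of `n`, and
  -- `j * u * v` is `j` plus a multiple of `n`.
  rep-inverse : ∀ {j} u v q → 0 < u → 0 < v → u * v ≡ 1 + q * n →
    0 < j → j ≤ n → rep (rep (j * u) * v) ≡ j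
  rep-inverse {j} u v q 0<u 0<v uv≡1 0<j j≤n = begin
    rep (rep a * v)
      ≡⟨ rep-+ (rep a * v) (k * v) (ℕ.*-mono-≤ {1} {rep a} (s≤s z≤n) 0<v) ⟨
    rep (rep a * v + k * v * n)
      ≡⟨ cong rep (solve 4 (λ r v k n → r :* v :+ k :* v :* n := (r :+ k :* n) :* v) refl (rep a) v k n) ⟩
    rep ((rep a + k * n) * v)
      ≡⟨ cong (λ b → rep (b * v)) (rep-≡ a (ℕ.*-mono-≤ 0<j 0<u)) ⟨
    rep (j * u * v)
      ≡⟨ cong rep (trans (ℕ.*-assoc j u v) (cong (j *_) uv≡1)) ⟩
    rep (j * (1 + q * n))
      ≡⟨ cong rep (solve 3 (λ j q n → j :* (con 1 :+ q :* n) := j :+ j :* q :* n) refl j q n) ⟩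
    rep (j + j * q * n)
      ≡⟨ rep-+ j (j * q) 0<j ⟩
    rep j
      ≡⟨ rep-id 0<j j≤n ⟩
    j ∎
    where
    open ≡-Reasoning
    a = j * u
    k = pred a / n

-- Over the natural numbers the Bézout identity comes with two signs. If `x * u` is 1 modulo `n`,
-- then `x` is the inverse; if it is - 1, then `x * (u * x)` is.
unit-inverse : ∀ {u n} → 0 < u → Coprime u n → ∃ λ v → ∃ λ q → 0 < v × u * v ≡ 1 + q * n
unit-inverse {u} {n} 0<u u⊥n with coprime-Bézout u⊥n
... | Bézout.+- zero    y ()
... | Bézout.+- (suc x) y eq = suc x , y , s≤s z≤n , trans (ℕ.*-comm u (suc x)) (sym eq)
... | Bézout.-+ x y eq = square (x * u) refl
  where
  -- (x u)² ≡ (-1)² modulo n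
  square : ∀ c → x * u ≡ c → ∃ λ v → ∃ λ q → 0 < v × u * v ≡ 1 + q * n
  -- Here `1 = y * n` forces `n = 1`. The general witness would be 0, which is not positive, so 1
  -- replaces it.
  square zero xu≡0 = 1 , pred u , s≤s z≤n , (begin
    u * 1               ≡⟨ ℕ.*-identityʳ u ⟩
    u                   ≡⟨ ℕ.suc-pred u {{ℕ.>-nonZero 0<u}} ⟨
    1 + pred u          ≡⟨ cong suc (ℕ.*-identityʳ (pred u)) ⟨
    1 + pred u * 1      ≡⟨ cong (λ k → 1 + pred u * k) (sym n≡1) ⟩
    1 + pred u * n      ∎)
    where
    open ≡-Reasoning
    n≡1 : n ≡ 1
    n≡1 = ∣1⇒≡1 (divides y (trans (cong suc (sym xu≡0)) eq))
  square (suc c) xu≡c = x * (u * x) , c * y , 0<v , (begin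
    u * (x * (u * x))
      ≡⟨ solve 2 (λ u x → u :* (x :* (u :* x)) := (x :* u) :* (x :* u)) refl u x ⟩
    (x * u) * (x * u)
      ≡⟨ cong₂ _*_ xu≡c xu≡c ⟩
    suc c * suc c
      ≡⟨ solve 1 (λ c → (con 1 :+ c) :* (con 1 :+ c)
           := con 1 :+ c :* (con 1 :+ (con 1 :+ c))) refl c ⟩
    1 + c * (1 + suc c)
      -- `1 + suc c` is `1 + x * u`, which the Bézout identity makes equal to `y * n`.
      ≡⟨ cong (λ k → 1 + c * k) (trans (cong suc (sym xu≡c)) eq) ⟩
    1 + c * (y * n)
      ≡⟨ cong suc (ℕ.*-assoc c y n) ⟨
    1 + c * y * n           ∎)
    where
    open ≡-Reasoning
    0<x : 0 < x
    0<x = ℕ.n≢0⇒n>0 λ { refl → ℕ.0≢1+n xu≡c }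
    0<v : 0 < x * (u * x)
    0<v = ℕ.*-mono-≤ 0<x (ℕ.*-mono-≤ 0<u 0<x)

-- Periodicity and unit invariance of Ramanujan sums

ζ-mod : ∀ n .{{_ : NonZero n}} a q → ζ n (a + q * n) ≈ ζ n a
ζ-mod n a zero    = subst (λ b → ζ n b ≈ ζ n a) (sym (ℕ.+-identityʳ a)) (≈-refl {ζ n a})
ζ-mod n a (suc q) = subst (λ b → ζ n b ≈ ζ n a)
  (trans (ℕ.+-assoc a (q * n) n) (cong (a +_) (ℕ.+-comm (q * n) n)))
  (≈-trans {ζ n (a + q * n + n)} {ζ n (a + q * n)} {ζ n a} (ζ-periodic n (a + q * n)) (ζ-mod n a q))

c-periodic : ∀ n .{{_ : NonZero n}} {l} → n ∣ l → ∀ k t → c n (k + t * l) ≈ c n k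
c-periodic n (divides q refl) k t = ∑-cong (totatives n)
  {λ j → ζ n (j * (k + t * (q * n)))} {λ j → ζ n (j * k)} λ {j} _ →
  subst (λ a → ζ n a ≈ ζ n (j * k))
    (solve 5 (λ j k t q n → j :* k :+ j :* t :* q :* n := j :* (k :+ t :* (q :* n))) refl j k t q n)
    (ζ-mod n (j * k) (j * t * q))

-- Replacing j by the residue of j u permutes the totatives; an inverse of `u` modulo `n` provides
-- the inverse permutation.
c-unit : ∀ n .{{_ : NonZero n}} {u} → 0 < u → Coprime u n → ∀ d → c n (u * d) ≈ c n d
c-unit n {u} 0<u u⊥n d with unit-inverse 0<u u⊥n
... | v , q , 0<v , uv≡1 = begin
    ∑ (totatives n) (λ j → ζ n (j * (u * d)))
      ≈⟨ ∑-cong (totatives n) {λ j → ζ n (j * (u * d))} {λ j → ζ n (σ j * d)} reduce ⟩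
    ∑ (totatives n) (λ j → ζ n (σ j * d))
      ≡⟨ ∑-map σ (totatives n) (λ j → ζ n (j * d)) ⟨
    ∑ (map σ (totatives n)) (λ j → ζ n (j * d))
      ≈⟨ ∑-↭ (λ j → ζ n (j * d)) (map-↭ σ τ (inverse u v uv≡1 0<u 0<v)
           (totatives-unique n) (totatives-unique n)
           (∈-rep n 0<u u⊥n) (∈-rep n 0<v v⊥n) (inverse v u (trans (ℕ.*-comm v u) uv≡1) 0<v 0<u)) ⟩
    ∑ (totatives n) (λ j → ζ n (j * d)) ∎
  where
  open ≈-Reasoning
  σ τ : ℕ → ℕ
  σ j = rep n (j * u)
  τ j = rep n (j * v)
  v⊥n : Coprime v n
  v⊥n {e} (e∣v , e∣n) = ∣1⇒≡1 (∣m+n∣m⇒∣n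
    (subst (e ∣_) (trans uv≡1 (ℕ.+-comm 1 (q * n))) (∣n⇒∣m*n u e∣v)) (∣n⇒∣m*n q e∣n))
  inverse : ∀ u v → u * v ≡ 1 + q * n → 0 < u → 0 < v → ∀ {j} → j ∈ totatives n →
    rep n (rep n (j * u) * v) ≡ j
  inverse u v uv≡1 0<u 0<v j∈ with ∈-totatives⁻ j∈
  ... | 0<j , j≤n , _ = rep-inverse n u v q 0<u 0<v uv≡1 0<j j≤n
  reduce : ∀ {j} → j ∈ totatives n → ζ n (j * (u * d)) ≈ ζ n (σ j * d)
  reduce {j} j∈ = subst (λ a → ζ n a ≈ ζ n (σ j * d))
    (trans (solve 4 (λ r k d n → r :* d :+ k :* d :* n := (r :+ k :* n) :* d) refl (σ j) k d n)
      (trans (cong (_* d) (sym (rep-≡ n (j * u) (ℕ.*-mono-≤ (proj₁ (∈-totatives⁻ {j} {n} j∈)) 0<u))))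
             (ℕ.*-assoc j u d)))
    (ζ-mod n (σ j * d) (k * d))
    where
    k = pred (j * u) / n

-- Lifting units to a larger modulus

-- The last component says that every prime factor of d divides t or u.
CoprimePart : ℕ → ℕ → Set
CoprimePart u d = ∃ λ t → Coprime t u × (∀ {e} → e ∣ d → Coprime e t → Coprime e u → e ≡ 1)

-- Strong induction on `d`, dividing by `gcd d u` until it is 1, when `d` itself serves as `t`. A
-- divisor of `d` coprime to `u` is coprime to the factor removed, hence divides the quotient, and
-- so the same `t` works for `d`.
coprimePart : ∀ u d → 0 < d → CoprimePart u d
coprimePart u = <-rec (λ d → 0 < d → CoprimePart u d) step
  where
  step : ∀ d → (∀ {d′} → d′ < d → 0 < d′ → CoprimePart u d′) → 0 < d → CoprimePart u d
  step d rec 0<d with gcd d u ℕ.≟ 1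
  ... | yes g≡1 = d , gcd≡1⇒coprime g≡1 , λ e∣d e⊥d _ → e⊥d (∣-refl , e∣d)
  ... | no  g≢1 with gcd[m,n]∣m d u
  ...   | divides d′ d≡d′g = extend (rec d′<d 0<d′)
    where
    g = gcd d u
    0<d′ : 0 < d′
    0<d′ = ℕ.n≢0⇒n>0 λ { refl → ℕ.<⇒≢ 0<d (sym d≡d′g) }
    1<g : 1 < g
    1<g = ℕ.≤∧≢⇒< (ℕ.n≢0⇒n>0 λ g≡0 → ℕ.<⇒≢ 0<d (sym (gcd[m,n]≡0⇒m≡0 {d} {u} g≡0))) (g≢1 ∘ sym)
    d′<d : d′ < d
    d′<d = subst (d′ <_) (sym d≡d′g) (ℕ.m<m*n d′ g {{ℕ.>-nonZero 0<d′}} 1<g)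
    extend : CoprimePart u d′ → CoprimePart u d
    extend (t , t⊥u , h) = t , t⊥u , λ {e} e∣d e⊥t e⊥u →
      h (coprime-divisor (coprime-∣ʳ (gcd[m,n]∣n d u) e⊥u)
          (subst (e ∣_) (trans d≡d′g (ℕ.*-comm d′ g)) e∣d)) e⊥t e⊥u

-- Modulo a prime factor of `M` the lift is congruent to `u`. A prime factor of `d` not dividing `M`
-- divides exactly one of `t` and `u`: in the first case the lift is congruent to `u`, in the second
-- to `t * M`, and neither is 0 modulo that prime.
lift-coprime : ∀ u M d → 0 < d → Coprime u M → ∃ λ t → Coprime (u + t * M) (M * d)
lift-coprime u M d 0<d u⊥M = lift (coprimePart u d 0<d)
  where
  lift : CoprimePart u d → ∃ λ t → Coprime (u + t * M) (M * d)
  lift (t , t⊥u , h) = t , λ {e} → coprime e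
    where
    module _ (e : ℕ) where
      coprime : e ∣ u + t * M × e ∣ M * d → e ≡ 1
      coprime (e∣v , e∣Md) = h (coprime-divisor e⊥M e∣Md) e⊥t e⊥u
        where
        e∣v′ : e ∣ t * M + u
        e∣v′ = subst (e ∣_) (ℕ.+-comm u (t * M)) e∣v
        e⊥M : Coprime e M
        e⊥M {g} (g∣e , g∣M) = u⊥M (∣m+n∣m⇒∣n (∣-trans g∣e e∣v′) (∣n⇒∣m*n t g∣M) , g∣M)
        e⊥t : Coprime e t
        e⊥t {g} (g∣e , g∣t) = t⊥u (g∣t , ∣m+n∣m⇒∣n (∣-trans g∣e e∣v′) (∣m⇒∣m*n M g∣t))
        e⊥u : Coprime e u
        e⊥u {g} (g∣e , g∣u) = u⊥M (g∣u , coprime-divisor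
          (λ (f∣g , f∣t) → t⊥u (f∣t , ∣-trans f∣g g∣u)) (∣m+n∣m⇒∣n (∣-trans g∣e e∣v) g∣u))

-- `u` is coprime to `M` but perhaps not to `n`. Moving `u` by a multiple of `M` changes `d * u` by
-- a multiple of `l`, which the sum does not see, and makes the factor coprime to `l`, so that
-- `c-unit` removes it.
c-gcd : ∀ n .{{_ : NonZero n}} {l} → n ∣ l → ∀ {d M} → 0 < d → l ≡ M * d →
  ∀ {u} → 0 < u → Coprime u M → c n (d * u) ≈ c n d
c-gcd n {l} n∣l {d} {M} 0<d l≡Md {u} 0<u u⊥M = go (lift-coprime u M d 0<d u⊥M)
  where
  go : (∃ λ t → Coprime (u + t * M) (M * d)) → c n (d * u) ≈ c n d
  go (t , v⊥Md) = begin
    c n (d * u)           ≈⟨ c-periodic n n∣l (d * u) t ⟨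
    c n (d * u + t * l)
      ≡⟨ cong (λ k → c n (d * u + t * k)) l≡Md ⟩
    c n (d * u + t * (M * d))
      ≡⟨ cong (c n) (solve 4 (λ d u t M → d :* u :+ t :* (M :* d) := (u :+ t :* M) :* d) refl d u t M) ⟩
    c n ((u + t * M) * d)
      ≈⟨ c-unit n (ℕ.≤-trans 0<u (ℕ.m≤m+n u (t * M)))
           (coprime-∣ʳ (subst (n ∣_) l≡Md n∣l) v⊥Md) d ⟩
    c n d                 ∎
    where open ≈-Reasoning

-- Partition of 1, ..., l by the gcd with l

-- The index list of `∑∣`: an entry `e` stands for the divisor `suc e`.
divisors : ℕ → List ℕ
divisors l = filter (λ e → suc e ∣? l) (upTo l)

gcd-class : ℕ → ℕ → List ℕ
gcd-class l d = filter (λ k → gcd k l ℕ.≟ d) [1⋯ l ]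

∈-gcd-class⁻ : ∀ {l d k} → k ∈ gcd-class l d → k ∈ [1⋯ l ] × gcd k l ≡ d
∈-gcd-class⁻ {l} {d} = ∈-filter⁻ (λ k → gcd k l ℕ.≟ d) {xs = [1⋯ l ]}

∈-gcd-class⁺ : ∀ {l d k} → k ∈ [1⋯ l ] → gcd k l ≡ d → k ∈ gcd-class l d
∈-gcd-class⁺ {l} {d} = ∈-filter⁺ (λ k → gcd k l ℕ.≟ d)

-- Each `k` lies in the class of `gcd k l` and in no other, so the concatenation has no repetitions;
-- that gcd is a positive divisor of `l`, so no `k` is missed.
partition-gcd : ∀ l .{{_ : NonZero l}} → concatMap (gcd-class l ∘ suc) (divisors l) ↭ [1⋯ l ]
partition-gcd l = ∼bag⇒↭ (unique∧set⇒bag unique ([1⋯]-unique l) (mk⇔ to from))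
  where
  class : ℕ → List ℕ
  class = gcd-class l ∘ suc
  disjoint : ∀ {e e′} → e ≢ e′ → Disjoint (class e) (class e′)
  disjoint {e} {e′} e≢e′ (k∈ , k∈′) = e≢e′ (ℕ.suc-injective
    (trans (sym (proj₂ (∈-gcd-class⁻ {l} {suc e} k∈))) (proj₂ (∈-gcd-class⁻ {l} {suc e′} k∈′))))
  unique : Unique (concatMap class (divisors l))
  unique = Unique.concat⁺
    (All.map⁺ (All.tabulate λ {e} _ → Unique.filter⁺ (λ k → gcd k l ℕ.≟ suc e) ([1⋯]-unique l)))
    (AllPairs.map⁺ (AllPairs.map disjoint (Unique.filter⁺ (λ e → suc e ∣? l) (Unique.upTo⁺ l))))
  to : ∀ {k} → k ∈ concatMap class (divisors l) → k ∈ [1⋯ l ]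
  to {k} k∈ with ∈-concat⁻′ (map class (divisors l)) k∈
  ... | _ , k∈ks , ks∈ with ∈-map⁻ class ks∈
  ... | e , _ , refl = proj₁ (∈-gcd-class⁻ {l} {suc e} k∈ks)
  from : ∀ {k} → k ∈ [1⋯ l ] → k ∈ concatMap class (divisors l)
  from {k} k∈ = choose (gcd k l) refl
    where
    choose : ∀ d → gcd k l ≡ d → k ∈ concatMap class (divisors l)
    choose zero    gcd≡0 = ⊥-elim (ℕ.≢-nonZero⁻¹ l (gcd[m,n]≡0⇒n≡0 k gcd≡0))
    choose (suc e) gcd≡d = ∈-concat⁺′ (∈-gcd-class⁺ k∈ gcd≡d)
      (∈-map⁺ class (∈-filter⁺ (λ e → suc e ∣? l) (∈-upTo⁺ (∣⇒≤ d∣l)) d∣l))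
      where
      d∣l : suc e ∣ l
      d∣l = subst (_∣ l) gcd≡d (gcd[m,n]∣n k l)

-- Since gcd (d u) (d M) = d gcd u M, multiplication and division by `d` are inverse bijections.
-- This shows that the class has `φ M` elements.
totatives-gcd-class : ∀ {l d M} .{{_ : NonZero d}} → l ≡ d * M →
  map (d *_) (totatives M) ↭ gcd-class l d
totatives-gcd-class {l} {d} {M} l≡dM = map-↭ (d *_) (_/ d)
    (λ {u} _ → trans (/-congˡ (ℕ.*-comm d u)) (m*n/n≡m u d))
    (totatives-unique M) (Unique.filter⁺ (λ k → gcd k l ℕ.≟ d) ([1⋯]-unique l))
    multiple cofactor (λ {k} k∈ → m*[n/m]≡n (d∣ k∈))
  where
  gcd-multiple : ∀ u → gcd (d * u) l ≡ d * gcd u M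
  gcd-multiple u = trans (cong (gcd (d * u)) l≡dM) (sym (c*gcd[m,n]≡gcd[cm,cn] d u M))
  multiple : ∀ {u} → u ∈ totatives M → d * u ∈ gcd-class l d
  multiple {u} u∈ with ∈-totatives⁻ {u} {M} u∈
  ... | 0<u , u≤M , u⊥M = ∈-gcd-class⁺ {l}
    (∈[1⋯]⁺ (ℕ.*-mono-≤ (ℕ.>-nonZero⁻¹ d) 0<u) (subst (d * u ≤_) (sym l≡dM) (ℕ.*-monoʳ-≤ d u≤M)))
    (trans (gcd-multiple u) (trans (cong (d *_) (coprime⇒gcd≡1 u⊥M)) (ℕ.*-identityʳ d)))
  d∣ : ∀ {k} → k ∈ gcd-class l d → d ∣ k
  d∣ {k} k∈ = subst (_∣ k) (proj₂ (∈-gcd-class⁻ {l} k∈)) (gcd[m,n]∣m k l)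
  cofactor : ∀ {k} → k ∈ gcd-class l d → k / d ∈ totatives M
  cofactor {k} k∈ = ∈-totatives⁺ 0<u u≤M (gcd≡1⇒coprime (ℕ.*-cancelˡ-≡ (gcd u M) 1 d (begin
      d * gcd u M       ≡⟨ gcd-multiple u ⟨
      gcd (d * u) l     ≡⟨ cong (λ k → gcd k l) du≡k ⟩
      gcd k l           ≡⟨ proj₂ (∈-gcd-class⁻ {l} k∈) ⟩
      d                 ≡⟨ ℕ.*-identityʳ d ⟨
      d * 1             ∎)))
    where
    open ≡-Reasoning
    u = k / d
    du≡k : d * u ≡ k
    du≡k = m*[n/m]≡n (d∣ k∈)
    0<k×k≤l : 0 < k × k ≤ l
    0<k×k≤l = ∈[1⋯]⁻ (proj₁ (∈-gcd-class⁻ {l} {d} k∈))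
    0<u : 0 < u
    0<u = ℕ.n≢0⇒n>0 λ u≡0 → ℕ.<⇒≢ (proj₁ 0<k×k≤l)
      (trans (sym (ℕ.*-zeroʳ d)) (trans (cong (d *_) (sym u≡0)) du≡k))
    u≤M : u ≤ M
    u≤M = ℕ.*-cancelˡ-≤ d (subst₂ _≤_ (sym du≡k) l≡dM (proj₂ 0<k×k≤l))

-- The hypothesis on `F` makes it constant on every gcd class, so the class of `d` contributes
-- `φ (l / d)` summands equal to `F d`.
∑-by-gcd : ∀ l .{{_ : NonZero l}} (F : ℕ → ℂ) →
  (∀ {d M} → 0 < d → l ≡ M * d → ∀ {u} → 0 < u → Coprime u M → F (d * u) ≈ F d) →
  ∑ [1⋯ l ] F ≈ ∑∣ l λ d → F d *ᶜ fromℚ (natℚ (φ (l / d)))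
∑-by-gcd l F F-gcd = begin
    ∑ [1⋯ l ] F
      ≈⟨ ∑-↭ F (partition-gcd l) ⟨
    ∑ (concatMap (gcd-class l ∘ suc) (divisors l)) F
      ≈⟨ ∑-concatMap (gcd-class l ∘ suc) (divisors l) F ⟩
    ∑ (divisors l) (λ e → ∑ (gcd-class l (suc e)) F)
      ≈⟨ ∑-cong (divisors l) {λ e → ∑ (gcd-class l (suc e)) F}
           {λ e → F (suc e) *ᶜ fromℚ (natℚ (φ (l / suc e)))} class ⟩
    ∑ (divisors l) (λ e → F (suc e) *ᶜ fromℚ (natℚ (φ (l / suc e)))) ∎
  where
  open ≈-Reasoning
  class : ∀ {e} → e ∈ divisors l → ∑ (gcd-class l (suc e)) F ≈ F (suc e) *ᶜ fromℚ (natℚ (φ (l / suc e)))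
  class {e} e∈ = begin
    ∑ (gcd-class l d) F
      ≈⟨ ∑-↭ F (totatives-gcd-class {l} {d} {M} (sym (m*[n/m]≡n d∣l))) ⟨
    ∑ (map (d *_) (totatives M)) F
      ≡⟨ ∑-map (d *_) (totatives M) F ⟩
    ∑ (totatives M) (λ u → F (d * u))
      ≈⟨ ∑-cong (totatives M) {λ u → F (d * u)} {λ _ → F d} constant ⟩
    ∑ (totatives M) (λ _ → F d)
      ≈⟨ ∑-const (totatives M) (F d) ⟩
    F d *ᶜ fromℚ (natℚ (φ M)) ∎
    where
    d = suc e
    M = l / d
    d∣l : d ∣ l
    d∣l = proj₂ (∈-filter⁻ (λ e → suc e ∣? l) {xs = upTo l} e∈)
    constant : ∀ {u} → u ∈ totatives M → F (d * u) ≈ F d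
    constant {u} u∈ with ∈-totatives⁻ {u} {M} u∈
    ... | 0<u , _ , u⊥M = F-gcd (s≤s z≤n) (sym (m/n*n≡m d∣l)) 0<u u⊥M

-- The mean of a product of Ramanujan sums

∣lcms : ∀ {r} (m : Fin r → ℕ) a → m a ∣ lcms m
∣lcms m Fin.zero    = m∣lcm[m,n] (m Fin.zero) (lcms (m ∘ Fin.suc))
∣lcms m (Fin.suc a) = ∣-trans (∣lcms (m ∘ Fin.suc) a) (n∣lcm[m,n] (m Fin.zero) (lcms (m ∘ Fin.suc)))

proposition9 :
    (r : ℕ) .{{_ : NonZero r}} (m : Fin r → ℕ) (pos : ∀ a → NonZero (m a)) →
    E m pos ≈ 1/lcms m pos *ᶜ ∑∣ (lcms m) λ d → ∏c m pos d *ᶜ fromℚ (natℚ (φ (lcms m / d)))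
proposition9 r m pos =
  *ᶜ-cong {1/lcms m pos} {1/lcms m pos} {∑ [1⋯ l ] (∏c m pos)}
    {∑∣ l λ d → ∏c m pos d *ᶜ fromℚ (natℚ (φ (l / d)))}
    (≈-refl {1/lcms m pos})
    -- Each modulus divides `l`, so every factor, and with it the product, is constant on the gcd
    -- classes of `l`.
    (∑-by-gcd l {{lcms-nonZero m pos}} (∏c m pos) λ {d} 0<d l≡Md {u} 0<u u⊥M →
      ∏-cong (allFin r) {λ a → c (m a) {{pos a}} (d * u)} {λ a → c (m a) {{pos a}} d}
        λ a → c-gcd (m a) {{pos a}} (∣lcms m a) 0<d l≡Md 0<u u⊥M)
  where l = lcms m
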